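{- There exists a Boolean function $f:\{0,1\}^n\to\{0,1\}$, computable by a depth-three $\mathsf{AC}^0$ circuit, for which any multilinear polynomial $p:\{0,1\}^n\to\mathbb{R}$ that satisfies $\mathrm{E}_{\mathcal{U}}\left[(p-f)^2\right]=o(1)$ also satisfies $$\deg(p)\cdot\mathrm{fat}(p)=\Omega\left(\frac{n}{\log^2 n}\right).$$
   Context: Here $f=f_n$ and $p=p_n$ are understood as families indexed by the input length $n$ (the subscript is dropped), and asymptotic notation is as $n\to\infty$. $\mathcal{U}$ is the uniform distribution over $\{0,1\}^n$. Circuits. $\mathsf{AC}^0$ circuits are circuits of AND, OR, and NOT gates with unbounded fanin, constant depth and size $n^{O(1)}$; depth is the number of alternating layers of AND and OR gates (NOT gates are not counted). Fat content. A term $C$ is a product of literals ($x_i$'s and $(1-x_i)$'s), each involving a different variable, and $|C|$ denotes the number of literals in it. For a multilinear polynomial $p:\{0,1\}^n\to\mathbb{R}$, the fat content $\mathrm{fat}(p)$ is the minimum of $\sum_C|\alpha_C|2^{ -|C|}$ over all representations $p=\sum_C\alpha_C C$ of $p$ as a linear combination of terms.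
   Formalization: In fat(p) only representations by terms with |C| ≤ deg(p) are allowed; with all representations fat(p) = E|p|, and the claim fails, since Linial–Mansour–Nisan truncations have polylogarithmic degree and E|p| ≤ 1. -}

module Defs where

open import Algebra.Bundles using (CommutativeMonoid)
import Algebra.Properties.CommutativeSemigroup as CommutativeSemigroupProperties
import Algebra.Properties.Group as GroupProperties
import Algebra.Properties.Ring as RingProperties
open import Data.Bool.Base using (Bool; true; false; not)
open import Data.Bool.ListAction using (and; or)
open import Data.Fin.Base using (Fin)
open import Data.Fin.Subset using (Subset; inside; outside; ∣_∣)
open import Data.Integer.Base using (+_)
open import Data.List.Base as List using (List; []; _∷_; foldr; cartesianProductWith)
open import Data.Maybe.Base using (Maybe; just; nothing; is-just)
open import Data.Nat.Base as ℕ using (ℕ; zero; suc; _⊔_)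
import Data.Nat.Properties as ℕ
open import Data.Product.Base using (Σ-syntax; ∃-syntax; _×_; _,_)
open import Data.Rational.Base as ℚ using (ℚ; 0ℚ; 1ℚ; ½)
import Data.Rational.Properties as ℚ
open import Data.Sum.Base using (inj₁; inj₂)
open import Data.Vec.Base as Vec using (Vec; []; _∷_; lookup; countᵇ)
open import Relation.Binary.PropositionalEquality using (_≡_; sym; trans; cong; cong₂; subst; module ≡-Reasoning)

Eventually : (ℕ → Set) → Set
Eventually P = Σ[ N ∈ ℕ ] (∀ n → N ℕ.≤ n → P n)

------------------------------------------------------------------------
-- Real numbers: Cauchy sequences of rationals, with equality _≃_.

IsCauchy : (ℕ → ℚ) → Set
IsCauchy s = ∀ ε → 0ℚ ℚ.< ε →
  Σ[ N ∈ ℕ ] (∀ m n → N ℕ.≤ m → N ℕ.≤ n → ℚ.∣ s m ℚ.- s n ∣ ℚ.≤ ε)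

record ℝ : Set where
  constructor mkℝ
  field
    seq    : ℕ → ℚ
    cauchy : IsCauchy seq

open ℝ public

infix 4 _≃_ _≤ℝ_

_≃_ : ℝ → ℝ → Set
x ≃ y = ∀ ε → 0ℚ ℚ.< ε → Eventually λ n → ℚ.∣ seq x n ℚ.- seq y n ∣ ℚ.≤ ε

_≤ℝ_ : ℝ → ℝ → Set
x ≤ℝ y = ∀ ε → 0ℚ ℚ.< ε → Eventually λ n → seq x n ℚ.≤ seq y n ℚ.+ ε

abstract

  private

    half-pos : ∀ {ε} → 0ℚ ℚ.< ε → 0ℚ ℚ.< ½ ℚ.* ε
    half-pos {ε} 0<ε =
      ℚ.positive⁻¹ (½ ℚ.* ε) {{ℚ.pos*pos⇒pos ½ ε {{ℚ.positive 0<ε}}}}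

    halves : ∀ ε → ½ ℚ.* ε ℚ.+ ½ ℚ.* ε ≡ ε
    halves ε = trans (sym (ℚ.*-distribʳ-+ ε ½ ½)) (ℚ.*-identityˡ ε)

    [p+q]-q≡p : ∀ p q → (p ℚ.+ q) ℚ.- q ≡ p
    [p+q]-q≡p p q = trans (ℚ.+-assoc p q (ℚ.- q))
      (trans (cong (p ℚ.+_) (ℚ.+-inverseʳ q)) (ℚ.+-identityʳ p))

    p≡q+[p-q] : ∀ p q → p ≡ q ℚ.+ (p ℚ.- q)
    p≡q+[p-q] p q = sym (trans (sym (ℚ.+-assoc q p (ℚ.- q)))
      (trans (cong (ℚ._- q) (ℚ.+-comm q p)) ([p+q]-q≡p p q)))

    -[p-q]≡q-p : ∀ p q → ℚ.- (p ℚ.- q) ≡ q ℚ.- p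
    -[p-q]≡q-p p q = trans (ℚ.neg-distrib-+ p (ℚ.- q))
      (trans (cong (ℚ.- p ℚ.+_) (⁻¹-involutive q)) (ℚ.+-comm (ℚ.- p) q))
      where open GroupProperties ℚ.+-0-group

    [p+q]-[r+s] : ∀ p q r s → (p ℚ.+ q) ℚ.- (r ℚ.+ s) ≡ (p ℚ.- r) ℚ.+ (q ℚ.- s)
    [p+q]-[r+s] p q r s = trans (cong ((p ℚ.+ q) ℚ.+_) (ℚ.neg-distrib-+ r s))
      (interchange p q (ℚ.- r) (ℚ.- s))
      where open CommutativeSemigroupProperties
                   (CommutativeMonoid.commutativeSemigroup ℚ.+-0-commutativeMonoid)

    pq-rs : ∀ p q r s →
      p ℚ.* q ℚ.- r ℚ.* s ≡ q ℚ.* (p ℚ.- r) ℚ.+ r ℚ.* (q ℚ.- s)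
    pq-rs p q r s = sym (begin
      q ℚ.* (p ℚ.- r) ℚ.+ r ℚ.* (q ℚ.- s)
        ≡⟨ cong₂ ℚ._+_ (x[y-z]≈xy-xz q p r) (x[y-z]≈xy-xz r q s) ⟩
      (q ℚ.* p ℚ.- q ℚ.* r) ℚ.+ (r ℚ.* q ℚ.- r ℚ.* s)
        ≡⟨ cong₂ (λ a b → (a ℚ.- b) ℚ.+ (r ℚ.* q ℚ.- r ℚ.* s))
             (ℚ.*-comm q p) (ℚ.*-comm q r) ⟩
      (p ℚ.* q ℚ.- r ℚ.* q) ℚ.+ (r ℚ.* q ℚ.- r ℚ.* s)
        ≡⟨ ℚ.+-assoc (p ℚ.* q) (ℚ.- (r ℚ.* q)) (r ℚ.* q ℚ.- r ℚ.* s) ⟩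
      p ℚ.* q ℚ.+ (ℚ.- (r ℚ.* q) ℚ.+ (r ℚ.* q ℚ.- r ℚ.* s))
        ≡⟨ cong (p ℚ.* q ℚ.+_) (\\-leftDividesʳ (r ℚ.* q) (ℚ.- (r ℚ.* s))) ⟩
      p ℚ.* q ℚ.- r ℚ.* s ∎)
      where open ≡-Reasoning
            open RingProperties ℚ.+-*-ring using (x[y-z]≈xy-xz)
            open GroupProperties ℚ.+-0-group using (\\-leftDividesʳ)

    ∣p∣-∣q∣≤∣p-q∣ : ∀ p q → ℚ.∣ p ∣ ℚ.- ℚ.∣ q ∣ ℚ.≤ ℚ.∣ p ℚ.- q ∣
    ∣p∣-∣q∣≤∣p-q∣ p q = begin
      ℚ.∣ p ∣ ℚ.- ℚ.∣ q ∣
        ≡⟨ cong (λ r → ℚ.∣ r ∣ ℚ.- ℚ.∣ q ∣) (p≡q+[p-q] p q) ⟩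
      ℚ.∣ q ℚ.+ (p ℚ.- q) ∣ ℚ.- ℚ.∣ q ∣
        ≤⟨ ℚ.+-monoˡ-≤ (ℚ.- ℚ.∣ q ∣) (ℚ.∣p+q∣≤∣p∣+∣q∣ q (p ℚ.- q)) ⟩
      (ℚ.∣ q ∣ ℚ.+ ℚ.∣ p ℚ.- q ∣) ℚ.- ℚ.∣ q ∣
        ≡⟨ cong (ℚ._- ℚ.∣ q ∣) (ℚ.+-comm ℚ.∣ q ∣ ℚ.∣ p ℚ.- q ∣) ⟩
      (ℚ.∣ p ℚ.- q ∣ ℚ.+ ℚ.∣ q ∣) ℚ.- ℚ.∣ q ∣
        ≡⟨ [p+q]-q≡p ℚ.∣ p ℚ.- q ∣ ℚ.∣ q ∣ ⟩
      ℚ.∣ p ℚ.- q ∣ ∎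
      where open ℚ.≤-Reasoning

    ∣p-q∣≡∣q-p∣ : ∀ p q → ℚ.∣ p ℚ.- q ∣ ≡ ℚ.∣ q ℚ.- p ∣
    ∣p-q∣≡∣q-p∣ p q =
      trans (cong ℚ.∣_∣ (sym (-[p-q]≡q-p q p))) (ℚ.∣-p∣≡∣p∣ (q ℚ.- p))

    ∣∣p∣-∣q∣∣≤∣p-q∣ : ∀ p q → ℚ.∣ ℚ.∣ p ∣ ℚ.- ℚ.∣ q ∣ ∣ ℚ.≤ ℚ.∣ p ℚ.- q ∣
    ∣∣p∣-∣q∣∣≤∣p-q∣ p q with ℚ.∣p∣≡p∨∣p∣≡-p (ℚ.∣ p ∣ ℚ.- ℚ.∣ q ∣)
    ... | inj₁ eq = ℚ.≤-trans (ℚ.≤-reflexive eq) (∣p∣-∣q∣≤∣p-q∣ p q)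
    ... | inj₂ eq = begin
      ℚ.∣ ℚ.∣ p ∣ ℚ.- ℚ.∣ q ∣ ∣  ≡⟨ eq ⟩
      ℚ.- (ℚ.∣ p ∣ ℚ.- ℚ.∣ q ∣)  ≡⟨ -[p-q]≡q-p ℚ.∣ p ∣ ℚ.∣ q ∣ ⟩
      ℚ.∣ q ∣ ℚ.- ℚ.∣ p ∣        ≤⟨ ∣p∣-∣q∣≤∣p-q∣ q p ⟩
      ℚ.∣ q ℚ.- p ∣              ≡⟨ ∣p-q∣≡∣q-p∣ q p ⟩
      ℚ.∣ p ℚ.- q ∣              ∎
      where open ℚ.≤-Reasoning

  const-cauchy : ∀ q → IsCauchy (λ _ → q)
  const-cauchy q ε 0<ε = 0 , λ _ _ _ _ →
    subst (ℚ._≤ ε) (cong ℚ.∣_∣ (sym (ℚ.+-inverseʳ q))) (ℚ.<⇒≤ 0<ε)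

  +-cauchy : ∀ {s t} → IsCauchy s → IsCauchy t → IsCauchy (λ n → s n ℚ.+ t n)
  +-cauchy {s} {t} cs ct ε 0<ε
    with cs (½ ℚ.* ε) (half-pos 0<ε) | ct (½ ℚ.* ε) (half-pos 0<ε)
  ... | M , hs | N , ht = M ⊔ N , λ m n M⊔N≤m M⊔N≤n → begin
    ℚ.∣ (s m ℚ.+ t m) ℚ.- (s n ℚ.+ t n) ∣
      ≡⟨ cong ℚ.∣_∣ ([p+q]-[r+s] (s m) (t m) (s n) (t n)) ⟩
    ℚ.∣ (s m ℚ.- s n) ℚ.+ (t m ℚ.- t n) ∣
      ≤⟨ ℚ.∣p+q∣≤∣p∣+∣q∣ (s m ℚ.- s n) (t m ℚ.- t n) ⟩
    ℚ.∣ s m ℚ.- s n ∣ ℚ.+ ℚ.∣ t m ℚ.- t n ∣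
      ≤⟨ ℚ.+-mono-≤ (hs m n (ℕ.m⊔n≤o⇒m≤o M N M⊔N≤m) (ℕ.m⊔n≤o⇒m≤o M N M⊔N≤n))
                    (ht m n (ℕ.m⊔n≤o⇒n≤o M N M⊔N≤m) (ℕ.m⊔n≤o⇒n≤o M N M⊔N≤n)) ⟩
    ½ ℚ.* ε ℚ.+ ½ ℚ.* ε
      ≡⟨ halves ε ⟩
    ε ∎
    where open ℚ.≤-Reasoning

  neg-cauchy : ∀ {s} → IsCauchy s → IsCauchy (λ n → ℚ.- s n)
  neg-cauchy {s} cs ε 0<ε with cs ε 0<ε
  ... | N , h = N , λ m n N≤m N≤n →
    subst (ℚ._≤ ε)
      (trans (sym (ℚ.∣-p∣≡∣p∣ (s m ℚ.- s n)))
        (cong ℚ.∣_∣ (ℚ.neg-distrib-+ (s m) (ℚ.- s n))))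
      (h m n N≤m N≤n)

  abs-cauchy : ∀ {s} → IsCauchy s → IsCauchy (λ n → ℚ.∣ s n ∣)
  abs-cauchy {s} cs ε 0<ε with cs ε 0<ε
  ... | N , h = N , λ m n N≤m N≤n →
    ℚ.≤-trans (∣∣p∣-∣q∣∣≤∣p-q∣ (s m) (s n)) (h m n N≤m N≤n)

  private

    eventual-bound : ∀ {s} → IsCauchy s →
      Σ[ B ∈ ℚ ] (ℚ.Positive B × Eventually λ n → ℚ.∣ s n ∣ ℚ.≤ B)
    eventual-bound {s} cs with cs 1ℚ (ℚ.positive⁻¹ 1ℚ)
    ... | N , h = ℚ.∣ s N ∣ ℚ.+ 1ℚ , B-pos , N , bound
      where
      open ℚ.≤-Reasoning
      B-pos : ℚ.Positive (ℚ.∣ s N ∣ ℚ.+ 1ℚ)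
      B-pos = ℚ.nonNeg+pos⇒pos ℚ.∣ s N ∣ {{ℚ.nonNegative (ℚ.0≤∣p∣ (s N))}} 1ℚ
      bound : ∀ n → N ℕ.≤ n → ℚ.∣ s n ∣ ℚ.≤ ℚ.∣ s N ∣ ℚ.+ 1ℚ
      bound n N≤n = begin
        ℚ.∣ s n ∣
          ≡⟨ cong ℚ.∣_∣ (p≡q+[p-q] (s n) (s N)) ⟩
        ℚ.∣ s N ℚ.+ (s n ℚ.- s N) ∣
          ≤⟨ ℚ.∣p+q∣≤∣p∣+∣q∣ (s N) (s n ℚ.- s N) ⟩
        ℚ.∣ s N ∣ ℚ.+ ℚ.∣ s n ℚ.- s N ∣
          ≤⟨ ℚ.+-monoʳ-≤ ℚ.∣ s N ∣ (h n N N≤n ℕ.≤-refl) ⟩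
        ℚ.∣ s N ∣ ℚ.+ 1ℚ ∎

    scale : ∀ B → ℚ.Positive B → ∀ ε → 0ℚ ℚ.< ε →
      Σ[ δ ∈ ℚ ] (0ℚ ℚ.< δ × B ℚ.* δ ≡ ε)
    scale B B-pos ε 0<ε = B⁻¹ ℚ.* ε , ℚ.positive⁻¹ (B⁻¹ ℚ.* ε) {{δ-pos}} , B*δ≡ε
      where
      B≢0 : ℚ.NonZero B
      B≢0 = ℚ.pos⇒nonZero B {{B-pos}}
      B⁻¹ : ℚ
      B⁻¹ = ℚ.1/_ B {{B≢0}}
      δ-pos : ℚ.Positive (B⁻¹ ℚ.* ε)
      δ-pos = ℚ.pos*pos⇒pos B⁻¹ {{ℚ.1/pos⇒pos B {{B-pos}}}} ε {{ℚ.positive 0<ε}}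
      B*δ≡ε : B ℚ.* (B⁻¹ ℚ.* ε) ≡ ε
      B*δ≡ε = trans (sym (ℚ.*-assoc B B⁻¹ ε))
             (trans (cong (ℚ._* ε) (ℚ.*-inverseʳ B {{B≢0}})) (ℚ.*-identityˡ ε))

    *-mono-∣∣ : ∀ p q {B δ} → ℚ.Positive B → ℚ.∣ p ∣ ℚ.≤ B → ℚ.∣ q ∣ ℚ.≤ δ →
      ℚ.∣ p ℚ.* q ∣ ℚ.≤ B ℚ.* δ
    *-mono-∣∣ p q {B} {δ} B-pos p≤B q≤δ = begin
      ℚ.∣ p ℚ.* q ∣        ≡⟨ ℚ.∣p*q∣≡∣p∣*∣q∣ p q ⟩
      ℚ.∣ p ∣ ℚ.* ℚ.∣ q ∣  ≤⟨ ℚ.*-monoʳ-≤-nonNeg ℚ.∣ q ∣ {{ℚ.nonNegative (ℚ.0≤∣p∣ q)}} p≤B ⟩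
      B ℚ.* ℚ.∣ q ∣        ≤⟨ ℚ.*-monoˡ-≤-nonNeg B {{ℚ.pos⇒nonNeg B {{B-pos}}}} q≤δ ⟩
      B ℚ.* δ              ∎
      where open ℚ.≤-Reasoning

  *-cauchy : ∀ {s t} → IsCauchy s → IsCauchy t → IsCauchy (λ n → s n ℚ.* t n)
  *-cauchy {s} {t} cs ct ε 0<ε
    with eventual-bound {s} cs | eventual-bound {t} ct
  ... | A , A-pos , K , bs | B , B-pos , L , bt
    with scale B B-pos (½ ℚ.* ε) (half-pos 0<ε) | scale A A-pos (½ ℚ.* ε) (half-pos 0<ε)
  ... | δ , 0<δ , Bδ≡ | η , 0<η , Aη≡
    with cs δ 0<δ | ct η 0<η
  ... | M , hs | N , ht = (K ⊔ L) ⊔ (M ⊔ N) , λ m n ≤m ≤n → begin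
    ℚ.∣ s m ℚ.* t m ℚ.- s n ℚ.* t n ∣
      ≡⟨ cong ℚ.∣_∣ (pq-rs (s m) (t m) (s n) (t n)) ⟩
    ℚ.∣ t m ℚ.* (s m ℚ.- s n) ℚ.+ s n ℚ.* (t m ℚ.- t n) ∣
      ≤⟨ ℚ.∣p+q∣≤∣p∣+∣q∣ (t m ℚ.* (s m ℚ.- s n)) (s n ℚ.* (t m ℚ.- t n)) ⟩
    ℚ.∣ t m ℚ.* (s m ℚ.- s n) ∣ ℚ.+ ℚ.∣ s n ℚ.* (t m ℚ.- t n) ∣
      ≤⟨ ℚ.+-mono-≤
           (*-mono-∣∣ (t m) (s m ℚ.- s n) B-pos (bt m (≤L ≤m)) (hs m n (≤M ≤m) (≤M ≤n)))
           (*-mono-∣∣ (s n) (t m ℚ.- t n) A-pos (bs n (≤K ≤n)) (ht m n (≤N ≤m) (≤N ≤n))) ⟩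
    B ℚ.* δ ℚ.+ A ℚ.* η
      ≡⟨ trans (cong (ℚ._+ (A ℚ.* η)) Bδ≡) (cong (½ ℚ.* ε ℚ.+_) Aη≡) ⟩
    ½ ℚ.* ε ℚ.+ ½ ℚ.* ε
      ≡⟨ halves ε ⟩
    ε ∎
    where
    open ℚ.≤-Reasoning
    ≤K : ∀ {m} → (K ⊔ L) ⊔ (M ⊔ N) ℕ.≤ m → K ℕ.≤ m
    ≤K h = ℕ.m⊔n≤o⇒m≤o K L (ℕ.m⊔n≤o⇒m≤o (K ⊔ L) (M ⊔ N) h)
    ≤L : ∀ {m} → (K ⊔ L) ⊔ (M ⊔ N) ℕ.≤ m → L ℕ.≤ m
    ≤L h = ℕ.m⊔n≤o⇒n≤o K L (ℕ.m⊔n≤o⇒m≤o (K ⊔ L) (M ⊔ N) h)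
    ≤M : ∀ {m} → (K ⊔ L) ⊔ (M ⊔ N) ℕ.≤ m → M ℕ.≤ m
    ≤M h = ℕ.m⊔n≤o⇒m≤o M N (ℕ.m⊔n≤o⇒n≤o (K ⊔ L) (M ⊔ N) h)
    ≤N : ∀ {m} → (K ⊔ L) ⊔ (M ⊔ N) ℕ.≤ m → N ℕ.≤ m
    ≤N h = ℕ.m⊔n≤o⇒n≤o M N (ℕ.m⊔n≤o⇒n≤o (K ⊔ L) (M ⊔ N) h)

infixl 7 _*ℝ_
infixl 6 _+ℝ_ _-ℝ_

fromℚ : ℚ → ℝ
fromℚ q = mkℝ (λ _ → q) (const-cauchy q)

fromℕ : ℕ → ℝ
fromℕ n = fromℚ (+ n ℚ./ 1)

0ℝ 1ℝ : ℝ
0ℝ = fromℚ 0ℚ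
1ℝ = fromℚ 1ℚ

_+ℝ_ _-ℝ_ _*ℝ_ : ℝ → ℝ → ℝ
x +ℝ y = mkℝ (λ n → seq x n ℚ.+ seq y n) (+-cauchy {seq x} {seq y} (cauchy x) (cauchy y))
x -ℝ y = mkℝ (λ n → seq x n ℚ.- seq y n) (+-cauchy {seq x} (cauchy x) (neg-cauchy {seq y} (cauchy y)))
x *ℝ y = mkℝ (λ n → seq x n ℚ.* seq y n) (*-cauchy {seq x} {seq y} (cauchy x) (cauchy y))

∣_∣ℝ : ℝ → ℝ
∣ x ∣ℝ = mkℝ (λ n → ℚ.∣ seq x n ∣) (abs-cauchy {seq x} (cauchy x))

_² : ℝ → ℝ
x ² = x *ℝ x

½^_ : ℕ → ℚ
½^ zero  = 1ℚ
½^ suc n = ½ ℚ.* (½^ n)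

∑ : {A : Set} → List A → (A → ℝ) → ℝ
∑ xs g = foldr (λ a r → g a +ℝ r) 0ℝ xs

-- g(n) = o(1)
Vanishing : (ℕ → ℝ) → Set
Vanishing g = ∀ ε → 0ℚ ℚ.< ε → Eventually λ n → ∣ g n ∣ℝ ≤ℝ fromℚ ε

------------------------------------------------------------------------
-- The Boolean cube

allVecs : {A : Set} → List A → ∀ n → List (Vec A n)
allVecs as zero    = [] ∷ []
allVecs as (suc n) = cartesianProductWith _∷_ as (allVecs as n)

Cube : ℕ → Set
Cube n = Vec Bool n

BooleanFamily : Set
BooleanFamily = ∀ n → Cube n → Bool

bit : Bool → ℝ
bit true  = 1ℝ
bit false = 0ℝ

𝔼 : ∀ {n} → (Cube n → ℝ) → ℝ
𝔼 {n} g = fromℚ (½^ n) *ℝ ∑ (allVecs (true ∷ false ∷ []) n) g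

------------------------------------------------------------------------
-- Circuits

-- A gate reads from w existing wires.
data Gate (w : ℕ) : Set where
  AND OR : List (Fin w) → Gate w
  NOT    : Fin w → Gate w

-- Gates are listed in topological order; every gate may read the n inputs and
-- all earlier gates (so fanout is unbounded too).
data Gates (n : ℕ) : ℕ → Set where
  inputs : Gates n 0
  _▷_    : ∀ {s} → Gates n s → Gate (s ℕ.+ n) → Gates n (suc s)

record Circuit (n : ℕ) : Set where
  constructor circuit
  field
    size   : ℕ
    gates  : Gates n size
    output : Fin (size ℕ.+ n)

open Circuit public

gateValue : ∀ {w} → Gate w → Vec Bool w → Bool
gateValue (AND js) v = and (List.map (lookup v) js)
gateValue (OR js)  v = or (List.map (lookup v) js)
gateValue (NOT j)  v = not (lookup v j)

values : ∀ {n s} → Gates n s → Cube n → Vec Bool (s ℕ.+ n)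
values inputs   x = x
values (gs ▷ g) x = gateValue g (values gs x) ∷ values gs x

-- The largest number of AND/OR gates on a path; NOT gates are free.
gateDepth : ∀ {w} → Gate w → Vec ℕ w → ℕ
gateDepth (AND js) v = suc (foldr _⊔_ 0 (List.map (lookup v) js))
gateDepth (OR js)  v = suc (foldr _⊔_ 0 (List.map (lookup v) js))
gateDepth (NOT j)  v = lookup v j

depths : ∀ {n s} → Gates n s → Vec ℕ (s ℕ.+ n)
depths {n} inputs = Vec.replicate n 0
depths (gs ▷ g)   = gateDepth g (depths gs) ∷ depths gs

run : ∀ {n} → Circuit n → Cube n → Bool
run C x = lookup (values (gates C) x) (output C)

depth : ∀ {n} → Circuit n → ℕ
depth C = lookup (depths (gates C)) (output C)

AC⁰-ofDepth : ℕ → BooleanFamily → Set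
AC⁰-ofDepth d f =
  Σ[ C ∈ (∀ n → Circuit n) ]
    ( (∀ n x → run (C n) x ≡ f n x)
    × (∀ n → depth (C n) ℕ.≤ d)
    × (Σ[ k ∈ ℕ ] (Eventually λ n → size (C n) ℕ.≤ n ℕ.^ k)))

------------------------------------------------------------------------
-- Multilinear polynomials

-- p S is the coefficient of ∏_{i ∈ S} xᵢ.
MultilinearPolynomial : ℕ → Set
MultilinearPolynomial n = Subset n → ℝ

monomial : ∀ {n} → Subset n → Cube n → ℝ
monomial []            []      = 1ℝ
monomial (inside  ∷ S) (b ∷ x) = bit b *ℝ monomial S x
monomial (outside ∷ S) (b ∷ x) = monomial S x

eval : ∀ {n} → MultilinearPolynomial n → Cube n → ℝ
eval {n} p x = ∑ (allVecs (inside ∷ outside ∷ []) n) λ S → p S *ℝ monomial S x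

DegreeAtMost : ∀ {n} → MultilinearPolynomial n → ℕ → Set
DegreeAtMost p d = ∀ S → d ℕ.< ∣ S ∣ → p S ≃ 0ℝ

-- Equality of reals is not decidable, so degree is a relation. The zero
-- polynomial has degree 0.
IsDegree : ∀ {n} → MultilinearPolynomial n → ℕ → Set
IsDegree p d = DegreeAtMost p d × (∀ e → DegreeAtMost p e → d ℕ.≤ e)

------------------------------------------------------------------------
-- Terms and fat content

-- just true is the literal xᵢ, just false is 1 - xᵢ, and nothing means that
-- the variable does not occur.
Term : ℕ → Set
Term n = Vec (Maybe Bool) n

∣_∣ₜ : ∀ {n} → Term n → ℕ
∣ C ∣ₜ = countᵇ is-just C

termValue : ∀ {n} → Term n → Cube n → ℝ
termValue []               []      = 1ℝ
termValue (just true  ∷ C) (b ∷ x) = bit b *ℝ termValue C x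
termValue (just false ∷ C) (b ∷ x) = (1ℝ -ℝ bit b) *ℝ termValue C x
termValue (nothing    ∷ C) (b ∷ x) = termValue C x

allTerms : ∀ n → List (Term n)
allTerms = allVecs (nothing ∷ just true ∷ just false ∷ [])

-- Terms longer than deg p are excluded. Otherwise one could expand p in the
-- point indicators (terms of length n), and the minimum weight below would
-- always be just 𝔼 ∣p∣, independently of the degree.
Represents : ∀ {n} → (Term n → ℝ) → MultilinearPolynomial n → Set
Represents {n} α p =
    (∀ x → ∑ (allTerms n) (λ C → α C *ℝ termValue C x) ≃ eval p x)
  × (∀ d → IsDegree p d → ∀ C → d ℕ.< ∣ C ∣ₜ → α C ≃ 0ℝ)

weight : ∀ {n} → (Term n → ℝ) → ℝ
weight {n} α = ∑ (allTerms n) λ C → ∣ α C ∣ℝ *ℝ fromℚ (½^ ∣ C ∣ₜ)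

-- φ is the minimum of weight over all representations of p.
IsFat : ∀ {n} → MultilinearPolynomial n → ℝ → Set
IsFat p φ = (∃[ α ] (Represents α p × (weight α ≃ φ)))
          × (∀ α → Represents α p → φ ≤ℝ weight α)

{-# OPTIONS --safe #-}
module Submission where

-- The function f reads its input as N blocks of m bits and asks whether every
-- y ∈ {0,1}ᵐ occurs as a block, where N ≈ M ln M for M = 2ᵐ makes the expected
-- number of missing y lie between 1/4 and 1/2. Let G(x) be the fraction of
-- missing y and μ = (1 - 1/M)ᴺ its mean. The test function h = 1 - G/μ equals 1
-- where f = 1, so E[hf] = Pr[f = 1] ≥ 1/2, while E[h²] ≤ 4. Conditioning on a
-- term C barely changes the law of the number of missing y, so that
-- ∣E[Ch]∣ ≤ (2d/M) 2^-∣C∣ for ∣C∣ ≤ d ≤ M/2 (for larger d take h = 1 instead).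
-- If p = Σ α_C C is close to f in L₂, then E[ph] is bounded below by a constant
-- and above by (2d/M) Σ ∣α_C∣ 2^-∣C∣. Hence d · fat(p) = Ω(M) = Ω(n / log² n).

open import Defs
open import Algebra.Bundles using (CommutativeRing)
open import Data.Bool.Base using (Bool; true; false; not; _∧_; _∨_)
open import Data.Bool.ListAction using (and; or)
open import Data.Empty using (⊥-elim)
open import Data.Fin.Base as Fin using (Fin; zero; suc; combine; remQuot)
open import Data.Fin.Properties using (remQuot-combine)
open import Data.Integer.Base as ℤ using (ℤ)
import Data.Integer.Properties as ℤ
open import Data.List.Base as List using (List; []; _∷_; foldr)
open import Data.List.Membership.Propositional using (_∈_)
open import Data.List.Membership.Propositional.Properties using (∈-cartesianProductWith⁺)
open import Data.List.Properties using (length-++; length-map; map-∘; map-cong)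
import Data.List.Relation.Unary.Any as Any
import Data.List.Relation.Unary.Any.Properties as Any
open import Data.Maybe.Base using (just; nothing)
open import Data.Nat.Base as ℕ using (ℕ; zero; suc; z≤n; s≤s; _⊔_)
open import Data.Nat.Logarithm using (⌊log₂_⌋; ⌊log₂⌋-mono-≤; ⌊log₂[2^n]⌋≡n)
import Data.Nat.Properties as ℕ
import Data.Nat.Tactic.RingSolver as ℕ-Solver
open import Data.Product.Base using (Σ-syntax; _×_; _,_; proj₁; proj₂)
open import Data.Rational.Base as ℚ using (ℚ; 0ℚ; 1ℚ; ½; _+_; _*_; _-_; _≤_; _<_)
open import Data.Rational.Properties
import Data.Rational.Unnormalised.Base as ℚᵘ
import Data.Rational.Unnormalised.Properties as ℚᵘ
open import Data.Sum.Base using (_⊎_; inj₁; inj₂)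
open import Data.Vec.Base as Vec using (Vec; []; _∷_; _++_; take; drop; lookup)
open import Data.Vec.Properties using (++-injectiveˡ; ++-injectiveʳ; take++drop≡id; lookup-++ˡ; lookup-++ʳ; lookup-replicate)
open import Function.Base using (_∘_)
open import Relation.Binary.PropositionalEquality using (_≡_; refl; sym; trans; cong; cong₂; subst)
open import Relation.Nullary using (¬_; Dec; yes; no)
open import Relation.Nullary.Decidable using (dec⇒maybe; toWitness)
open import Tactic.RingSolver using (solve-∀)
open import Tactic.RingSolver.Core.AlmostCommutativeRing using (AlmostCommutativeRing; fromCommutativeRing)
open import Algebra.Properties.Semiring.Exp (CommutativeRing.semiring +-*-commutativeRing)
  using (_^_; ^-homo-*; ^-assocʳ)

-- The function `1 - G/μ` has mean zero, and its correlation with `C` is, up to sign, 2^-∣C∣ times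
-- the relative change of the mean of G when `C` is imposed. A block that `C` does not mention still
-- avoids y with probability 1 - 1/M. A mentioned block avoids y with probability at most 1, so the
-- mean grows by at most a factor (1 - 1/M)^-∣C∣. From below no estimate holds for each single y,
-- since `C` may force a block to equal y. But whatever `C` says, a block equals a uniformly random
-- y with probability exactly 1/M, so averaging the union bound over y loses only ∣C∣/M. The window
-- for Mμ has two uses. Mμ ≤ 1/2 gives Pr[f = 1] ≥ 1/2 by Markov, and Mμ ≥ 1/4 bounds the second
-- moment by 1/(Mμ) ≤ 4, the events that y and y′ ≠ y are missing being negatively correlated. One
-- logarithm in the final bound is the block length m, the other comes from N/M. The estimates are
-- made over ℚ, at one index of the Cauchy sequences. There the coefficients of terms longer than
-- deg p are merely small, not zero, so these terms need a separate crude bound.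

private variable
  x y z w : ℚ
  n m : ℕ

-- Rational inequalities

ℚ-ring : AlmostCommutativeRing _ _
ℚ-ring = fromCommutativeRing +-*-commutativeRing λ x → dec⇒maybe (0ℚ ≟ x)

≤-by : ∀ e → 0ℚ ≤ e → y ≡ x + e → x ≤ y
≤-by {x = x} e 0≤e refl = subst (_≤ x + e) (+-identityʳ x) (+-monoʳ-≤ x 0≤e)

0≤-diff : x ≤ y → 0ℚ ≤ y - x
0≤-diff {x} {y} x≤y = subst (_≤ y - x) (+-inverseʳ x) (+-monoˡ-≤ (ℚ.- x) x≤y)

0≤+ : 0ℚ ≤ x → 0ℚ ≤ y → 0ℚ ≤ x + y
0≤+ = +-mono-≤

0≤* : 0ℚ ≤ x → 0ℚ ≤ y → 0ℚ ≤ x * y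
0≤* {x} {y} 0≤x 0≤y = nonNegative⁻¹ (x * y)
  {{nonNeg*nonNeg⇒nonNeg x {{ℚ.nonNegative 0≤x}} y {{ℚ.nonNegative 0≤y}}}}

0≤² : ∀ x → 0ℚ ≤ x * x
0≤² x with ≤-total 0ℚ x
... | inj₁ 0≤x = 0≤* 0≤x 0≤x
... | inj₂ x≤0 = subst (0ℚ ≤_) (square x) (0≤* (0≤-diff x≤0) (0≤-diff x≤0))
  where
  square : ∀ x → (0ℚ - x) * (0ℚ - x) ≡ x * x
  square = solve-∀ ℚ-ring

*-mono : 0ℚ ≤ x → 0ℚ ≤ z → x ≤ y → z ≤ w → x * z ≤ y * w
*-mono {x} {z} {y} {w} 0≤x 0≤z x≤y z≤w =
  ≤-trans (*-monoʳ-≤-nonNeg z {{ℚ.nonNegative 0≤z}} x≤y)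
          (*-monoˡ-≤-nonNeg y {{ℚ.nonNegative (≤-trans 0≤x x≤y)}} z≤w)

*-monoˡ : 0ℚ ≤ z → x ≤ y → z * x ≤ z * y
*-monoˡ {z} 0≤z = *-monoˡ-≤-nonNeg z {{ℚ.nonNegative 0≤z}}

0≤½ : 0ℚ ≤ ½
0≤½ = toWitness {a? = 0ℚ ≤? ½} _

0≤1 : 0ℚ ≤ 1ℚ
0≤1 = toWitness {a? = 0ℚ ≤? 1ℚ} _

-- Expectation over the cube

at : Bool → (Cube (suc n) → ℚ) → Cube n → ℚ
at b f x = f (b ∷ x)

mean : ℚ → ℚ → ℚ
mean a b = ½ * (a + b)

mean-cong : x ≡ y → z ≡ w → mean x z ≡ mean y w
mean-cong = cong₂ mean

mean-idem : ∀ a → ½ * (a + a) ≡ a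
mean-idem = solve-∀ ℚ-ring

abstract

  -- Averaging bit by bit, rather than summing over a list as `𝔼` does, makes linearity and the
  -- splitting of the cube into blocks direct inductions; `½^*sum≡E` reconciles the two. Being
  -- abstract, it does not unfold into a tree of 2ⁿ values.
  E : (Cube n → ℚ) → ℚ
  E {zero}  g = g []
  E {suc n} g = mean (E (at true g)) (E (at false g))

  E-zero : (g : Cube 0 → ℚ) → E g ≡ g []
  E-zero g = refl

  E-suc : (g : Cube (suc n) → ℚ) → E g ≡ mean (E (at true g)) (E (at false g))
  E-suc g = refl

  E-cong : {f g : Cube n → ℚ} → (∀ x → f x ≡ g x) → E f ≡ E g
  E-cong {zero}          f≡g = f≡g []
  E-cong {suc n} {f} {g} f≡g =
    mean-cong {E (at true f)} {E (at true g)}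
      (E-cong {n} {at true f} {at true g} λ x → f≡g (true ∷ x))
      (E-cong {n} {at false f} {at false g} λ x → f≡g (false ∷ x))

  E-mono : {f g : Cube n → ℚ} → (∀ x → f x ≤ g x) → E f ≤ E g
  E-mono {zero}          f≤g = f≤g []
  E-mono {suc n} {f} {g} f≤g = *-monoˡ 0≤½ (+-mono-≤
    (E-mono {n} {at true f} {at true g} λ x → f≤g (true ∷ x))
    (E-mono {n} {at false f} {at false g} λ x → f≤g (false ∷ x)))

  E-const : ∀ n c → E {n} (λ _ → c) ≡ c
  E-const zero    c = refl
  E-const (suc n) c = trans (cong (λ e → mean e e) (E-const n c)) (mean-idem c)

  E-+ : (f g : Cube n → ℚ) → E (λ x → f x + g x) ≡ E f + E g
  E-+ {zero}  f g = refl
  E-+ {suc n} f g = trans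
    (mean-cong (E-+ {n} (at true f) (at true g)) (E-+ {n} (at false f) (at false g)))
    (regroup (E (at true f)) (E (at true g)) (E (at false f)) (E (at false g)))
    where
    regroup : ∀ a b c d → ½ * ((a + b) + (c + d)) ≡ ½ * (a + c) + ½ * (b + d)
    regroup = solve-∀ ℚ-ring

  E-*ˡ : ∀ c (f : Cube n → ℚ) → E (λ x → c * f x) ≡ c * E f
  E-*ˡ {zero}  c f = refl
  E-*ˡ {suc n} c f = trans
    (mean-cong (E-*ˡ {n} c (at true f)) (E-*ˡ {n} c (at false f)))
    (regroup c (E (at true f)) (E (at false f)))
    where
    regroup : ∀ c a b → ½ * (c * a + c * b) ≡ c * (½ * (a + b))
    regroup = solve-∀ ℚ-ring

  E-++ : ∀ m {n} (g : Cube (m ℕ.+ n) → ℚ) → E g ≡ E {m} (λ x → E {n} (λ y → g (x ++ y)))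
  E-++ zero    g = refl
  E-++ (suc m) g = mean-cong (E-++ m (at true g)) (E-++ m (at false g))

E-*ʳ : ∀ c (f : Cube n → ℚ) → E (λ x → f x * c) ≡ E f * c
E-*ʳ c f = trans (E-cong λ x → *-comm (f x) c) (trans (E-*ˡ c f) (*-comm c (E f)))

E-nonNeg : {f : Cube n → ℚ} → (∀ x → 0ℚ ≤ f x) → 0ℚ ≤ E f
E-nonNeg {n} {f} 0≤f = subst (_≤ E f) (E-const n 0ℚ) (E-mono 0≤f)

E-- : (f g : Cube n → ℚ) → E (λ x → f x - g x) ≡ E f - E g
E-- f g = trans (E-cong λ x → l (f x) (g x))
  (trans (E-+ f (λ x → (ℚ.- 1ℚ) * g x)) (trans (cong (E f +_) (E-*ˡ (ℚ.- 1ℚ) g)) (sym (l (E f) (E g)))))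
  where
  l : ∀ a b → a - b ≡ a + (ℚ.- 1ℚ) * b
  l = solve-∀ ℚ-ring

E-swap : (g : Cube n → Cube m → ℚ) → E (λ x → E (g x)) ≡ E (λ y → E (λ x → g x y))
E-swap {zero}  {m} g = trans (E-zero _) (E-cong λ y → sym (E-zero _))
E-swap {suc n} {m} g = trans (E-suc _) (trans
  (cong₂ mean (E-swap {n} {m} (λ x → g (true ∷ x))) (E-swap {n} {m} (λ x → g (false ∷ x))))
  (trans (cong (½ *_) (sym (E-+ gᵗ gᶠ)))
  (trans (sym (E-*ˡ ½ (λ y → gᵗ y + gᶠ y))) (E-cong λ y → sym (E-suc (λ x → g x y))))))
  where
  gᵗ gᶠ : Cube m → ℚ
  gᵗ y = E λ x → g (true ∷ x) y
  gᶠ y = E λ x → g (false ∷ x) y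

E-product : ∀ m {n} (f : Cube m → ℚ) (g : Cube n → ℚ) (h : Cube (m ℕ.+ n) → ℚ) →
  (∀ x y → h (x ++ y) ≡ f x * g y) → E h ≡ E f * E g
E-product m f g h h≡ = trans (E-++ m h)
  (trans (E-cong λ x → trans (E-cong (h≡ x)) (E-*ˡ (f x) g)) (E-*ʳ (E g) f))

sum : {A : Set} → List A → (A → ℚ) → ℚ
sum xs g = foldr (λ a r → g a + r) 0ℚ xs

E-sum : {A : Set} (as : List A) (g : A → Cube n → ℚ) →
  E (λ x → sum as (λ a → g a x)) ≡ sum as (λ a → E (g a))
E-sum {n} []   g = E-const n 0ℚ
E-sum (a ∷ as) g = trans (E-+ (g a) _) (cong (E (g a) +_) (E-sum as g))

-- Point masses and terms

½^-nonNeg : ∀ n → 0ℚ ≤ ½^ n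
½^-nonNeg zero    = 0≤1
½^-nonNeg (suc n) = 0≤* 0≤½ (½^-nonNeg n)

½^-+ : ∀ m n → ½^ (m ℕ.+ n) ≡ ½^ m * ½^ n
½^-+ zero    n = sym (*-identityˡ (½^ n))
½^-+ (suc m) n = trans (cong (½ *_) (½^-+ m n)) (sym (*-assoc ½ (½^ m) (½^ n)))

½^≤1 : ∀ n → ½^ n ≤ 1ℚ
½^≤1 zero    = ≤-refl
½^≤1 (suc n) = ≤-trans (*-monoˡ 0≤½ (½^≤1 n)) (toWitness {a? = ½ * 1ℚ ≤? 1ℚ} _)

bitℚ : Bool → ℚ
bitℚ true  = 1ℚ
bitℚ false = 0ℚ

agree : Bool → Bool → ℚ
agree true  b = bitℚ b
agree false b = 1ℚ - bitℚ b

δ : Cube m → Cube m → ℚ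
δ []      []      = 1ℚ
δ (b ∷ x) (c ∷ y) = agree b c * δ x y

E-δ : (f : Cube m → ℚ) (y : Cube m) → E (λ x → f x * δ x y) ≡ ½^ m * f y
E-δ {zero}  f [] = trans (E-zero _) (*-comm (f []) 1ℚ)
E-δ {suc m} f (true ∷ y) = trans (E-suc _) (trans
  (cong₂ mean (trans (E-cong λ x → kept (f (true ∷ x)) (δ x y)) (E-δ (at true f) y))
              (trans (E-cong λ x → killed (f (false ∷ x)) (δ x y)) (E-const m 0ℚ)))
  (halve (½^ m) (f (true ∷ y))))
  where
  kept : ∀ a b → a * (1ℚ * b) ≡ a * b
  kept = solve-∀ ℚ-ring
  killed : ∀ a b → a * ((1ℚ - 1ℚ) * b) ≡ 0ℚ
  killed = solve-∀ ℚ-ring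
  halve : ∀ a b → ½ * (a * b + 0ℚ) ≡ ½ * a * b
  halve = solve-∀ ℚ-ring
E-δ {suc m} f (false ∷ y) = trans (E-suc _) (trans
  (cong₂ mean (trans (E-cong λ x → killed (f (true ∷ x)) (δ x y)) (E-const m 0ℚ))
              (trans (E-cong λ x → kept (f (false ∷ x)) (δ x y)) (E-δ (at false f) y)))
  (halve (½^ m) (f (false ∷ y))))
  where
  kept : ∀ a b → a * ((1ℚ - 0ℚ) * b) ≡ a * b
  kept = solve-∀ ℚ-ring
  killed : ∀ a b → a * (0ℚ * b) ≡ 0ℚ
  killed = solve-∀ ℚ-ring
  halve : ∀ a b → ½ * (0ℚ + a * b) ≡ ½ * a * b
  halve = solve-∀ ℚ-ring

δ-01 : (x y : Cube m) → δ x y ≡ 0ℚ ⊎ δ x y ≡ 1ℚ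
δ-01 [] [] = inj₂ refl
δ-01 (b ∷ x) (c ∷ y) with b | c | δ-01 x y
... | true  | true  | inj₁ eq = inj₁ (trans (*-identityˡ _) eq)
... | true  | true  | inj₂ eq = inj₂ (trans (*-identityˡ _) eq)
... | true  | false | _ = inj₁ (*-zeroˡ (δ x y))
... | false | true  | _ = inj₁ (*-zeroˡ (δ x y))
... | false | false | inj₁ eq = inj₁ (trans (*-identityˡ _) eq)
... | false | false | inj₂ eq = inj₂ (trans (*-identityˡ _) eq)

termℚ : Term n → Cube n → ℚ
termℚ []               []      = 1ℚ
termℚ (just true  ∷ C) (b ∷ x) = bitℚ b * termℚ C x
termℚ (just false ∷ C) (b ∷ x) = (1ℚ - bitℚ b) * termℚ C x
termℚ (nothing    ∷ C) (b ∷ x) = termℚ C x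

termℚ-++ : (C₁ : Term m) (C₂ : Term n) (x : Cube m) (y : Cube n) →
  termℚ (C₁ ++ C₂) (x ++ y) ≡ termℚ C₁ x * termℚ C₂ y
termℚ-++ []                C₂ []      y = sym (*-identityˡ _)
termℚ-++ (just true  ∷ C₁) C₂ (b ∷ x) y = trans (cong (bitℚ b *_) (termℚ-++ C₁ C₂ x y)) (sym (*-assoc (bitℚ b) _ _))
termℚ-++ (just false ∷ C₁) C₂ (b ∷ x) y = trans (cong ((1ℚ - bitℚ b) *_) (termℚ-++ C₁ C₂ x y)) (sym (*-assoc (1ℚ - bitℚ b) _ _))
termℚ-++ (nothing    ∷ C₁) C₂ (b ∷ x) y = termℚ-++ C₁ C₂ x y

∣∣ₜ-++ : (C₁ : Term m) (C₂ : Term n) → ∣ C₁ ++ C₂ ∣ₜ ≡ ∣ C₁ ∣ₜ ℕ.+ ∣ C₂ ∣ₜ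
∣∣ₜ-++ []             C₂ = refl
∣∣ₜ-++ (just _  ∷ C₁) C₂ = cong suc (∣∣ₜ-++ C₁ C₂)
∣∣ₜ-++ (nothing ∷ C₁) C₂ = ∣∣ₜ-++ C₁ C₂

E-termℚ : (C : Term n) → E (termℚ C) ≡ ½^ ∣ C ∣ₜ
E-termℚ [] = E-zero (termℚ [])
E-termℚ (just true ∷ C) = trans (E-suc _) (trans
  (cong₂ mean (E-*ˡ 1ℚ (termℚ C)) (E-*ˡ 0ℚ (termℚ C)))
  (trans (halve (E (termℚ C))) (cong (½ *_) (E-termℚ C))))
  where
  halve : ∀ a → ½ * (1ℚ * a + 0ℚ * a) ≡ ½ * a
  halve = solve-∀ ℚ-ring
E-termℚ (just false ∷ C) = trans (E-suc _) (trans
  (cong₂ mean (E-*ˡ (1ℚ - 1ℚ) (termℚ C)) (E-*ˡ (1ℚ - 0ℚ) (termℚ C)))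
  (trans (halve (E (termℚ C))) (cong (½ *_) (E-termℚ C))))
  where
  halve : ∀ a → ½ * ((1ℚ - 1ℚ) * a + (1ℚ - 0ℚ) * a) ≡ ½ * a
  halve = solve-∀ ℚ-ring
E-termℚ (nothing ∷ C) = trans (E-suc _) (trans (mean-idem (E (termℚ C))) (E-termℚ C))

termℚ-01 : (C : Term n) (x : Cube n) → termℚ C x ≡ 0ℚ ⊎ termℚ C x ≡ 1ℚ
termℚ-01 [] [] = inj₂ refl
termℚ-01 (just true  ∷ C) (true  ∷ x) = subst (λ t → t ≡ 0ℚ ⊎ t ≡ 1ℚ) (sym (*-identityˡ (termℚ C x))) (termℚ-01 C x)
termℚ-01 (just true  ∷ C) (false ∷ x) = inj₁ (*-zeroˡ (termℚ C x))
termℚ-01 (just false ∷ C) (true  ∷ x) = inj₁ (*-zeroˡ (termℚ C x))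
termℚ-01 (just false ∷ C) (false ∷ x) = subst (λ t → t ≡ 0ℚ ⊎ t ≡ 1ℚ) (sym (*-identityˡ (termℚ C x))) (termℚ-01 C x)
termℚ-01 (nothing    ∷ C) (b     ∷ x) = termℚ-01 C x

01-nonNeg : x ≡ 0ℚ ⊎ x ≡ 1ℚ → 0ℚ ≤ x
01-nonNeg (inj₁ refl) = ≤-refl
01-nonNeg (inj₂ refl) = 0≤1

termℚ-empty : (C : Term n) → ∣ C ∣ₜ ≡ 0 → ∀ x → termℚ C x ≡ 1ℚ
termℚ-empty []            _  []      = refl
termℚ-empty (nothing ∷ C) eq (b ∷ x) = termℚ-empty C eq x

-- Natural numbers and powers inside ℚ

ι : ℕ → ℚ
ι n = ℤ.+ n ℚ./ 1

-- The fraction defining `ι` is normalised, so the equation is checked on unnormalised rationals and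
-- carried back.
ι-suc : ∀ n → ι (suc n) ≡ 1ℚ + ι n
ι-suc n = toℚᵘ-injective
  (ℚᵘ.≃-trans (toℚᵘ-fromℚᵘ (ℚᵘ.mkℚᵘ (ℤ.+ suc n) 0))
  (ℚᵘ.≃-trans (ℚᵘ.*≡* (cong (λ k → (ℤ.+ 1 ℤ.+ k) ℤ.* ℤ.+ 1) (sym (ℤ.*-identityʳ (ℤ.+ n)))))
  (ℚᵘ.≃-trans (ℚᵘ.+-congʳ ℚᵘ.1ℚᵘ (ℚᵘ.≃-sym (toℚᵘ-fromℚᵘ (ℚᵘ.mkℚᵘ (ℤ.+ n) 0))))
              (ℚᵘ.≃-sym (toℚᵘ-homo-+ 1ℚ (ι n))))))

ι-+ : ∀ m n → ι (m ℕ.+ n) ≡ ι m + ι n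
ι-+ zero    n = sym (+-identityˡ (ι n))
ι-+ (suc m) n = trans (ι-suc (m ℕ.+ n)) (trans (cong (1ℚ +_) (ι-+ m n))
  (trans (sym (+-assoc 1ℚ (ι m) (ι n))) (cong (_+ ι n) (sym (ι-suc m)))))

ι-* : ∀ m n → ι (m ℕ.* n) ≡ ι m * ι n
ι-* zero    n = sym (*-zeroˡ (ι n))
ι-* (suc m) n = trans (ι-+ n (m ℕ.* n)) (trans (cong (ι n +_) (ι-* m n))
  (trans (regroup (ι m) (ι n)) (cong (_* ι n) (sym (ι-suc m)))))
  where
  regroup : ∀ a b → b + a * b ≡ (1ℚ + a) * b
  regroup = solve-∀ ℚ-ring

ι-nonNeg : ∀ n → 0ℚ ≤ ι n
ι-nonNeg zero    = ≤-refl
ι-nonNeg (suc n) = subst (0ℚ ≤_) (sym (ι-suc n)) (0≤+ 0≤1 (ι-nonNeg n))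

ι-mono : m ℕ.≤ n → ι m ≤ ι n
ι-mono {m} {n} m≤n = ≤-by (ι (n ℕ.∸ m)) (ι-nonNeg (n ℕ.∸ m))
  (trans (cong ι (sym (ℕ.m+[n∸m]≡n m≤n))) (ι-+ m (n ℕ.∸ m)))

^-nonNeg : ∀ n → 0ℚ ≤ x → 0ℚ ≤ x ^ n
^-nonNeg zero    0≤x = 0≤1
^-nonNeg (suc n) 0≤x = 0≤* 0≤x (^-nonNeg n 0≤x)

*-≤ˡ : 0ℚ ≤ y → x ≤ 1ℚ → x * y ≤ y
*-≤ˡ {y} {x} 0≤y x≤1 = subst (x * y ≤_) (*-identityˡ y) (*-monoʳ-≤-nonNeg y {{ℚ.nonNegative 0≤y}} x≤1)

-- Missing blocks

module Blocks (m r : ℕ) where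

  -- The `r` bits after the last block are padding, so that every input length is reached. The
  -- recursion lets a cube of `suc N` blocks be, by definition, one block followed by the rest.
  length : ℕ → ℕ
  length zero    = r
  length (suc N) = m ℕ.+ length N

  h q : ℚ
  h = ½^ m
  q = 1ℚ - h

  0≤h : 0ℚ ≤ h
  0≤h = ½^-nonNeg m

  0≤q : 0ℚ ≤ q
  0≤q = 0≤-diff (½^≤1 m)

  q≤1 : q ≤ 1ℚ
  q≤1 = ≤-by h 0≤h (l h)
    where
    l : ∀ h → 1ℚ ≡ 1ℚ - h + h
    l = solve-∀ ℚ-ring

  q^≤1 : ∀ n → q ^ n ≤ 1ℚ
  q^≤1 zero    = ≤-refl
  q^≤1 (suc n) = ≤-trans (*-≤ˡ (^-nonNeg n 0≤q) q≤1) (q^≤1 n)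

  miss : ∀ N → Cube m → Cube (length N) → ℚ
  miss zero    y x = 1ℚ
  miss (suc N) y x = (1ℚ - δ (take m x) y) * miss N y (drop m x)

  miss-++ : ∀ N y z (w : Cube (length N)) →
    miss (suc N) y (z ++ w) ≡ (1ℚ - δ z y) * miss N y w
  miss-++ N y z w = cong₂ (λ z w → (1ℚ - δ z y) * miss N y w)
    (++-injectiveˡ (take m (z ++ w)) z (take++drop≡id m (z ++ w)))
    (++-injectiveʳ (take m (z ++ w)) z (take++drop≡id m (z ++ w)))

  1-δ-01 : ∀ z (y : Cube m) → 1ℚ - δ z y ≡ 0ℚ ⊎ 1ℚ - δ z y ≡ 1ℚ
  1-δ-01 z y with δ z y | δ-01 z y
  ... | _ | inj₁ refl = inj₂ refl
  ... | _ | inj₂ refl = inj₁ refl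

  miss-01 : ∀ N y x → miss N y x ≡ 0ℚ ⊎ miss N y x ≡ 1ℚ
  miss-01 zero    y x = inj₂ refl
  miss-01 (suc N) y x with 1ℚ - δ (take m x) y | 1-δ-01 (take m x) y | miss N y (drop m x) | miss-01 N y (drop m x)
  ... | _ | inj₁ refl | b | _    = inj₁ (*-zeroˡ b)
  ... | _ | inj₂ refl | _ | inj₁ refl = inj₁ refl
  ... | _ | inj₂ refl | _ | inj₂ refl = inj₂ refl

  -- This is ½^∣C∣ times the probability, given `C`, that `y` is missing.
  W : ∀ N → Term (length N) → Cube m → ℚ
  W N C y = E (λ x → termℚ C x * miss N y x)

  -- The probability that one uniform block satisfies `C` and differs from `y`; see `E-factor`.
  factor : Term m → Cube m → ℚ
  factor C y = ½^ ∣ C ∣ₜ - h * termℚ C y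

  E-factor : ∀ C y → E (λ z → termℚ C z * (1ℚ - δ z y)) ≡ factor C y
  E-factor C y = trans (E-cong λ z → l (termℚ C z) (δ z y))
    (trans (E-- (termℚ C) (λ z → termℚ C z * δ z y)) (cong₂ _-_ (E-termℚ C) (E-δ (termℚ C) y)))
    where
    l : ∀ a b → a * (1ℚ - b) ≡ a - a * b
    l = solve-∀ ℚ-ring

  factor-nonNeg : ∀ C y → 0ℚ ≤ factor C y
  factor-nonNeg C y = subst (0ℚ ≤_) (E-factor C y)
    (E-nonNeg λ z → 0≤* (01-nonNeg (termℚ-01 C z)) (01-nonNeg (1-δ-01 z y)))

  W-++ : ∀ N (C₁ : Term m) (C₂ : Term (length N)) y →
    W (suc N) (C₁ ++ C₂) y ≡ factor C₁ y * W N C₂ y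
  W-++ N C₁ C₂ y = trans
    (E-product m (λ z → termℚ C₁ z * (1ℚ - δ z y)) (λ w → termℚ C₂ w * miss N y w) _ λ z w →
      trans (cong₂ _*_ (termℚ-++ C₁ C₂ z w) (miss-++ N y z w)) (l (termℚ C₁ z) (termℚ C₂ w) (1ℚ - δ z y) (miss N y w)))
    (cong (_* W N C₂ y) (E-factor C₁ y))
    where
    l : ∀ a b c d → (a * b) * (c * d) ≡ (a * c) * (b * d)
    l = solve-∀ ℚ-ring

  -- Q is (1 - 1/M) to the number of blocks not mentioned by C, and D y / 2^-∣C∣
  -- is the union bound, over the blocks mentioned by C, on the probability that
  -- y occurs in one of them given C.
  record Bounds (N : ℕ) (C : Term (length N)) : Set where
    field
      Q        : ℚ
      D        : Cube m → ℚ
      0≤Q      : 0ℚ ≤ Q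
      qᴺ≤Q     : q ^ N ≤ Q
      q^∣C∣Q≤qᴺ : q ^ ∣ C ∣ₜ * Q ≤ q ^ N
      0≤D      : ∀ y → 0ℚ ≤ D y
      lower    : ∀ y → Q * (½^ ∣ C ∣ₜ - D y) ≤ W N C y
      upper    : ∀ y → W N C y ≤ Q * ½^ ∣ C ∣ₜ
      E-D      : E D ≤ ι ∣ C ∣ₜ * h * ½^ ∣ C ∣ₜ

  -- Without blocks, `C` speaks of padding bits only. They never make `y` occur, so `D` vanishes
  -- even if `C` has literals.
  bounds-empty : ∀ C → Bounds 0 C
  bounds-empty C = record
    { Q = 1ℚ ; D = λ _ → 0ℚ ; 0≤Q = 0≤1 ; qᴺ≤Q = ≤-refl
    ; q^∣C∣Q≤qᴺ = subst (_≤ 1ℚ) (sym (*-identityʳ (q ^ ∣ C ∣ₜ))) (q^≤1 ∣ C ∣ₜ)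
    ; 0≤D = λ _ → ≤-refl
    ; lower = λ y → ≤-reflexive (trans (l (½^ ∣ C ∣ₜ)) (sym (W≡ y)))
    ; upper = λ y → ≤-reflexive (trans (W≡ y) (sym (*-identityˡ (½^ ∣ C ∣ₜ))))
    ; E-D = subst (_≤ ι ∣ C ∣ₜ * h * ½^ ∣ C ∣ₜ) (sym (E-const m 0ℚ))
              (0≤* (0≤* (ι-nonNeg ∣ C ∣ₜ) 0≤h) (½^-nonNeg ∣ C ∣ₜ))
    }
    where
    l : ∀ a → 1ℚ * (a - 0ℚ) ≡ a
    l = solve-∀ ℚ-ring
    W≡ : ∀ y → W 0 C y ≡ ½^ ∣ C ∣ₜ
    W≡ y = trans (E-cong λ x → *-identityʳ (termℚ C x)) (E-termℚ C)

  module _ {N} {C₁ : Term m} {C₂ : Term (length N)} (B : Bounds N C₂) where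
    open Bounds B
    private
      t₁ t₂ t : ℕ
      t₁ = ∣ C₁ ∣ₜ
      t₂ = ∣ C₂ ∣ₜ
      t  = ∣ C₁ ++ C₂ ∣ₜ
      A₁ A₂ A : ℚ
      A₁ = ½^ t₁
      A₂ = ½^ t₂
      A  = ½^ t

      t≡ : t ≡ t₁ ℕ.+ t₂
      t≡ = ∣∣ₜ-++ C₁ C₂

      A≡ : A ≡ A₁ * A₂
      A≡ = trans (cong ½^_ t≡) (½^-+ t₁ t₂)

    -- A block free of literals is independent of `C` and contributes exactly `q`, which is absorbed
    -- into `Q` without any loss in `D`.
    bounds-untouched : t₁ ≡ 0 → Bounds (suc N) (C₁ ++ C₂)
    bounds-untouched t₁≡0 = record
      { Q = q * Q ; D = D ; 0≤Q = 0≤* 0≤q 0≤Q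
      ; qᴺ≤Q = *-monoˡ 0≤q qᴺ≤Q
      ; q^∣C∣Q≤qᴺ = subst (_≤ q * q ^ N) (trans (swap q (q ^ t₂) Q) (cong (λ t → q ^ t * (q * Q)) (sym t≡t₂)))
                     (*-monoˡ 0≤q q^∣C∣Q≤qᴺ)
      ; 0≤D = 0≤D
      ; lower = λ y → subst₂′ (trans (sym (*-assoc q Q _)) (cong (λ t → q * Q * (½^ t - D y)) (sym t≡t₂))) (sym (W≡ y))
                     (*-monoˡ 0≤q (lower y))
      ; upper = λ y → subst₂′ (sym (W≡ y)) (trans (sym (*-assoc q Q _)) (cong (λ t → q * Q * ½^ t) (sym t≡t₂)))
                     (*-monoˡ 0≤q (upper y))
      ; E-D = subst (λ t → E D ≤ ι t * h * ½^ t) (sym t≡t₂) E-D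
      }
      where
      subst₂′ : ∀ {a b c d} → a ≡ b → c ≡ d → a ≤ c → b ≤ d
      subst₂′ refl refl a≤c = a≤c
      t≡t₂ : t ≡ t₂
      t≡t₂ = trans t≡ (cong (ℕ._+ t₂) t₁≡0)
      swap : ∀ a b c → a * (b * c) ≡ b * (a * c)
      swap = solve-∀ ℚ-ring
      W≡ : ∀ y → W (suc N) (C₁ ++ C₂) y ≡ q * W N C₂ y
      W≡ y = trans (W-++ N C₁ C₂ y) (cong (_* W N C₂ y)
        (cong₂ _-_ (cong ½^_ t₁≡0) (trans (cong (h *_) (termℚ-empty C₁ t₁≡0 y)) (*-identityʳ h))))

    -- Here `Q` stays fixed: the block's factor is at most `A₁`, and its deficit `h * termℚ C₁ y`
    -- goes into `D`. Since `Q` gains no factor `q` while the number of blocks grows, one of the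
    -- literals of `C₁` must pay for it in `power`; there is one by hypothesis.
    bounds-touched : ∀ {k} → t₁ ≡ suc k → Bounds (suc N) (C₁ ++ C₂)
    bounds-touched {k} t₁≡1+k = record
      { Q = Q ; D = D′ ; 0≤Q = 0≤Q
      ; qᴺ≤Q = ≤-trans (*-≤ˡ (^-nonNeg N 0≤q) q≤1) qᴺ≤Q
      ; q^∣C∣Q≤qᴺ = power
      ; 0≤D = λ y → 0≤+ (0≤* (0≤* 0≤h (0≤term y)) 0≤A₂) (0≤* 0≤A₁ (0≤D y))
      ; lower = λ y → ≤-trans
          -- Discarding the product of the two deficits is the union bound.
          (≤-by (Q * (h * termℚ C₁ y * D y)) (0≤* 0≤Q (0≤* (0≤* 0≤h (0≤term y)) (0≤D y)))
            (trans (expand A₁ A₂ (h * termℚ C₁ y) (D y) Q)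
                   (cong (λ a → Q * (a - D′ y) + Q * (h * termℚ C₁ y * D y)) (sym A≡))))
          (≤-trans (*-monoˡ (factor-nonNeg C₁ y) (lower y)) (≤-reflexive (sym (W-++ N C₁ C₂ y))))
      ; upper = λ y → ≤-trans (≤-reflexive (W-++ N C₁ C₂ y))
          (≤-trans (*-monoˡ (factor-nonNeg C₁ y) (upper y))
          (≤-by (h * termℚ C₁ y * (Q * A₂)) (0≤* (0≤* 0≤h (0≤term y)) (0≤* 0≤Q 0≤A₂))
            (trans (cong (Q *_) A≡) (collect A₁ A₂ (h * termℚ C₁ y) Q))))
      ; E-D = ≤-trans (≤-reflexive E-D′)
          (≤-trans (+-monoʳ-≤ (h * A₁ * A₂) (*-monoˡ 0≤A₁ E-D))
          -- The block adds `h * A` to the mean of `D` however many literals it carries, because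
          -- `termℚ C₁` has mean `A₁`. The allowance for the other `k` literals is slack.
          (≤-by (ι k * (h * A)) (0≤* (ι-nonNeg k) (0≤* 0≤h (½^-nonNeg t)))
            (trans (cong (λ i → i * h * A) (trans (cong ι t≡) (trans (ι-+ t₁ t₂) (cong (_+ ι t₂) (trans (cong ι t₁≡1+k) (ι-suc k))))))
            (trans (split (ι k) (ι t₂) h A) (cong (_+ ι k * (h * A)) (trans (cong (λ a → h * a + ι t₂ * h * a) A≡) (share A₁ A₂ h (ι t₂))))))))
      }
      where
      0≤A₁ : 0ℚ ≤ A₁
      0≤A₁ = ½^-nonNeg t₁
      0≤A₂ : 0ℚ ≤ A₂
      0≤A₂ = ½^-nonNeg t₂
      0≤term : ∀ y → 0ℚ ≤ termℚ C₁ y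
      0≤term y = 01-nonNeg (termℚ-01 C₁ y)
      D′ : Cube m → ℚ
      D′ y = h * termℚ C₁ y * A₂ + A₁ * D y
      expand : ∀ a₁ a₂ b d q → (a₁ - b) * (q * (a₂ - d)) ≡ q * (a₁ * a₂ - (b * a₂ + a₁ * d)) + q * (b * d)
      expand = solve-∀ ℚ-ring
      collect : ∀ a₁ a₂ b q → q * (a₁ * a₂) ≡ (a₁ - b) * (q * a₂) + b * (q * a₂)
      collect = solve-∀ ℚ-ring
      split : ∀ k t h a → (1ℚ + k + t) * h * a ≡ h * a + t * h * a + k * (h * a)
      split = solve-∀ ℚ-ring
      share : ∀ a₁ a₂ h t → h * (a₁ * a₂) + t * h * (a₁ * a₂) ≡ h * a₁ * a₂ + a₁ * (t * h * a₂)
      share = solve-∀ ℚ-ring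
      E-D′ : E D′ ≡ h * A₁ * A₂ + A₁ * E D
      E-D′ = trans (E-+ (λ y → h * termℚ C₁ y * A₂) (λ y → A₁ * D y))
        (cong₂ _+_ (trans (E-*ʳ A₂ (λ y → h * termℚ C₁ y)) (cong (_* A₂) (trans (E-*ˡ h (termℚ C₁)) (cong (h *_) (E-termℚ C₁)))))
                   (E-*ˡ A₁ D))
      regroup : ∀ a b c d → (a * b) * c * d ≡ b * (a * (c * d))
      regroup = solve-∀ ℚ-ring
      power : q ^ t * Q ≤ q * q ^ N
      power = ≤-trans
        (≤-reflexive (trans (cong (_* Q) (trans (cong (q ^_) t≡) (trans (^-homo-* q t₁ t₂) (cong (λ s → q ^ s * q ^ t₂) t₁≡1+k))))
                            (regroup q (q ^ k) (q ^ t₂) Q)))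
        (≤-trans (*-≤ˡ (0≤* 0≤q (0≤* (^-nonNeg t₂ 0≤q) 0≤Q)) (q^≤1 k))
                 (*-monoˡ 0≤q q^∣C∣Q≤qᴺ))

  bounds : ∀ N C → Bounds N C
  bounds zero    C = bounds-empty C
  bounds (suc N) C with Vec.splitAt m C
  ... | C₁ , C₂ , refl with ∣ C₁ ∣ₜ in eq
  ...   | zero  = bounds-untouched {C₁ = C₁} (bounds N C₂) eq
  ...   | suc k = bounds-touched {C₁ = C₁} (bounds N C₂) eq

-- The test function

∈-allVecs : {A : Set} (as : List A) → (∀ a → a ∈ as) → (v : Vec A n) → v ∈ allVecs as n
∈-allVecs as all []      = Any.here refl
∈-allVecs as all (a ∷ v) = ∈-cartesianProductWith⁺ _∷_ (all a) (∈-allVecs as all v)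

cubes : ∀ n → List (Cube n)
cubes n = allVecs (true ∷ false ∷ []) n

∈-cubes : (x : Cube n) → x ∈ cubes n
∈-cubes = ∈-allVecs _ λ { true → Any.here refl ; false → Any.there (Any.here refl) }

⋀ ⋁ : (Fin n → Bool) → Bool
⋀ {zero}  g = true
⋀ {suc n} g = g zero ∧ ⋀ (λ i → g (suc i))
⋁ {zero}  g = false
⋁ {suc n} g = g zero ∨ ⋁ (λ i → g (suc i))

⋀-cong : {f g : Fin n → Bool} → (∀ i → f i ≡ g i) → ⋀ f ≡ ⋀ g
⋀-cong {zero}  f≡g = refl
⋀-cong {suc n} f≡g = cong₂ _∧_ (f≡g zero) (⋀-cong λ i → f≡g (suc i))

⋁-cong : {f g : Fin n → Bool} → (∀ i → f i ≡ g i) → ⋁ f ≡ ⋁ g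
⋁-cong {zero}  f≡g = refl
⋁-cong {suc n} f≡g = cong₂ _∨_ (f≡g zero) (⋁-cong λ i → f≡g (suc i))

⋀-true : (g : Fin n → Bool) → ⋀ g ≡ true → ∀ i → g i ≡ true
⋀-true {suc n} g eq i with g zero in eq₀ | ⋀ (λ i → g (suc i)) in eq₁
⋀-true {suc n} g eq zero    | true | true = eq₀
⋀-true {suc n} g eq (suc i) | true | true = ⋀-true (λ i → g (suc i)) eq₁ i

⋀-false : (g : Fin n → Bool) → ⋀ g ≡ false → Σ[ i ∈ Fin n ] g i ≡ false
⋀-false {suc n} g eq with g zero in eq₀
... | false = zero , eq₀
... | true  with ⋀-false (λ i → g (suc i)) eq
...   | i , gᵢ = suc i , gᵢ

literal : Bool → Bool → Bool
literal true  b = b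
literal false b = not b

agree-literal : ∀ b c → agree b c ≡ bitℚ (literal c b)
agree-literal true  true  = refl
agree-literal true  false = refl
agree-literal false true  = refl
agree-literal false false = refl

bitℚ-∧ : ∀ a b → bitℚ (a ∧ b) ≡ bitℚ a * bitℚ b
bitℚ-∧ true  b = sym (*-identityˡ (bitℚ b))
bitℚ-∧ false b = sym (*-zeroˡ (bitℚ b))

bitℚ-∨ : ∀ a b → 1ℚ - bitℚ (a ∨ b) ≡ (1ℚ - bitℚ a) * (1ℚ - bitℚ b)
bitℚ-∨ true  b = sym (*-zeroˡ (1ℚ - bitℚ b))
bitℚ-∨ false b = sym (*-identityˡ (1ℚ - bitℚ b))

δ≡⋀ : (x y : Cube m) → δ x y ≡ bitℚ (⋀ λ i → literal (lookup y i) (lookup x i))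
δ≡⋀ []      []      = refl
δ≡⋀ (b ∷ x) (c ∷ y) = trans (cong₂ _*_ (agree-literal b c) (δ≡⋀ x y)) (sym (bitℚ-∧ (literal c b) _))

-- A dual certificate: `h` correlates with `f`, has bounded norm, and is nearly orthogonal to every
-- term of at most `d` literals. The last bound comes with both signs because the coefficients of a
-- representation may have either sign.
record Test {n} (f : Cube n → Bool) (d : ℕ) (κ : ℚ) : Set where
  field
    h       : Cube n → ℚ
    E-hf    : ½ ≤ E (λ x → h x * bitℚ (f x))
    E-hh    : E (λ x → h x * h x) ≤ ι 4
    E-Ch≤   : ∀ C → ∣ C ∣ₜ ℕ.≤ d → E (λ x → termℚ C x * h x) ≤ κ * ½^ ∣ C ∣ₜ
    -E-Ch≤  : ∀ C → ∣ C ∣ₜ ℕ.≤ d → ℚ.- E (λ x → termℚ C x * h x) ≤ κ * ½^ ∣ C ∣ₜ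

-- The hard function and the moments of the fraction of missing strings

module Surjectivity (m r : ℕ) where
  open Blocks m r

  pos : ∀ N → Fin N → Fin m → Fin (length N)
  pos (suc N) zero    i = i Fin.↑ˡ length N
  pos (suc N) (suc j) i = m Fin.↑ʳ pos N j i

  hit : ∀ N → Cube m → Cube (length N) → Bool
  hit N y x = ⋁ λ j → ⋀ λ i → literal (lookup y i) (lookup x (pos N j i))

  images : List (Cube m)
  images = cubes m

  surjective : ∀ N → Cube (length N) → Bool
  surjective N x = ⋀ λ k → hit N (List.lookup images k) x

  miss≡hit : ∀ N y x → miss N y x ≡ 1ℚ - bitℚ (hit N y x)
  miss≡hit zero    y x = refl
  miss≡hit (suc N) y x with Vec.splitAt m x
  ... | z , w , refl = trans
    (cong₂ _*_
      (cong (1ℚ -_) (trans (δ≡⋀ z y) (cong bitℚ (⋀-cong λ i → cong (literal (lookup y i)) (sym (lookup-++ˡ z w i))))))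
      (trans (miss≡hit N y w)
        (cong (λ b → 1ℚ - bitℚ b) (⋁-cong λ j → ⋀-cong λ i → cong (literal (lookup y i)) (sym (lookup-++ʳ z w (pos N j i)))))))
    (sym (bitℚ-∨ (⋀ λ i → literal (lookup y i) (lookup (z ++ w) (i Fin.↑ˡ length N))) _))

  G : ∀ N → Cube (length N) → ℚ
  G N x = E λ y → miss N y x

  surjective⇒G≡0 : ∀ N x → surjective N x ≡ true → G N x ≡ 0ℚ
  surjective⇒G≡0 N x onto = trans (E-cong miss≡0) (E-const m 0ℚ)
    where
    miss≡0 : ∀ y → miss N y x ≡ 0ℚ
    miss≡0 y = trans (miss≡hit N y x) (cong (λ b → 1ℚ - bitℚ b)
      (subst (λ y → hit N y x ≡ true) (sym (Any.lookup-index (∈-cubes y)))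
        (⋀-true (λ k → hit N (List.lookup images k) x) onto (Any.index (∈-cubes y)))))

  -- One missing string `y₀` already has weight 2^-m in the average; the point mass `δ y y₀`
  -- isolates its contribution.
  ¬surjective⇒h≤G : ∀ N x → surjective N x ≡ false → h ≤ G N x
  ¬surjective⇒h≤G N x ¬onto with ⋀-false (λ k → hit N (List.lookup images k) x) ¬onto
  ... | k , ¬hit = subst (_≤ G N x)
    (trans (E-δ (λ y → miss N y x) y₀) (trans (cong (h *_) (trans (miss≡hit N y₀ x) (cong (λ b → 1ℚ - bitℚ b) ¬hit))) (*-identityʳ h)))
    (E-mono λ y → ≤-by (miss N y x * (1ℚ - δ y y₀)) (0≤* (01-nonNeg (miss-01 N y x)) (01-nonNeg (1-δ-01 y y₀)))
      (split (miss N y x) (δ y y₀)))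
    where
    y₀ : Cube m
    y₀ = List.lookup images k
    split : ∀ a b → a ≡ a * b + a * (1ℚ - b)
    split = solve-∀ ℚ-ring

  E-1-δ : (y : Cube m) → E (λ z → 1ℚ - δ z y) ≡ q
  E-1-δ y = trans (E-- (λ _ → 1ℚ) (λ z → δ z y)) (cong₂ _-_ (E-const m 1ℚ)
    (trans (E-cong λ z → sym (*-identityˡ (δ z y))) (trans (E-δ (λ _ → 1ℚ) y) (*-identityʳ h))))

  E-miss : ∀ N y → E (miss N y) ≡ q ^ N
  E-miss zero    y = E-const r 1ℚ
  E-miss (suc N) y = trans (E-product m (λ z → 1ℚ - δ z y) (miss N y) _ (miss-++ N y))
    (cong₂ _*_ (E-1-δ y) (E-miss N y))

  E-G : ∀ N → E (G N) ≡ q ^ N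
  E-G N = trans (E-swap (λ x y → miss N y x)) (trans (E-cong (E-miss N)) (E-const m (q ^ N)))

  pair : Cube m → Cube m → ℚ
  pair y y′ = 1ℚ - h - h + h * δ y y′

  E-pair : ∀ y y′ → E (λ z → (1ℚ - δ z y) * (1ℚ - δ z y′)) ≡ pair y y′
  E-pair y y′ = trans (E-cong λ z → expand (δ z y) (δ z y′))
    (trans (E-+ (λ z → 1ℚ - δ z y - 1ℚ * δ z y′) (λ z → δ z y′ * δ z y))
      (cong₂ _+_ (trans (E-- (λ z → 1ℚ - δ z y) (λ z → 1ℚ * δ z y′))
                   (cong₂ _-_ (E-1-δ y) (trans (E-δ (λ _ → 1ℚ) y′) (*-identityʳ h))))
        (E-δ (λ z → δ z y′) y)))
    where
    expand : ∀ a b → (1ℚ - a) * (1ℚ - b) ≡ 1ℚ - a - 1ℚ * b + b * a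
    expand = solve-∀ ℚ-ring

  -- The probability that y and y′ are both missing.
  V : ∀ N → Cube m → Cube m → ℚ
  V N y y′ = E (λ x → miss N y x * miss N y′ x)

  V-nonNeg : ∀ N y y′ → 0ℚ ≤ V N y y′
  V-nonNeg N y y′ = E-nonNeg λ x → 0≤* (01-nonNeg (miss-01 N y x)) (01-nonNeg (miss-01 N y′ x))

  pair-nonNeg : ∀ y y′ → 0ℚ ≤ pair y y′
  pair-nonNeg y y′ = subst (0ℚ ≤_) (E-pair y y′)
    (E-nonNeg λ z → 0≤* (01-nonNeg (1-δ-01 z y)) (01-nonNeg (1-δ-01 z y′)))

  V-suc : ∀ N y y′ → V (suc N) y y′ ≡ pair y y′ * V N y y′
  V-suc N y y′ = trans
    (E-product m (λ z → (1ℚ - δ z y) * (1ℚ - δ z y′)) (λ w → miss N y w * miss N y′ w) _ λ z w →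
      trans (cong₂ _*_ (miss-++ N y z w) (miss-++ N y′ z w))
            (interchange (1ℚ - δ z y) (1ℚ - δ z y′) (miss N y w) (miss N y′ w)))
    (cong (_* V N y y′) (E-pair y y′))
    where
    interchange : ∀ a b c d → (a * c) * (b * d) ≡ (a * b) * (c * d)
    interchange = solve-∀ ℚ-ring

  -- Negative correlation: one block avoids two distinct strings with probability 1 - 2h ≤ (1 - h)²,
  -- and the blocks are independent.
  V-≢ : ∀ N y y′ → δ y y′ ≡ 0ℚ → V N y y′ ≤ q ^ N * q ^ N
  V-≢ zero    y y′ _  = ≤-reflexive (E-const r (1ℚ * 1ℚ))
  V-≢ (suc N) y y′ eq = ≤-trans (≤-reflexive (V-suc N y y′)) (≤-trans
    (*-mono (pair-nonNeg y y′) (V-nonNeg N y y′)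
      (≤-by (h * h) (0≤² h) (trans (square h) (cong (λ e → 1ℚ - h - h + h * e + h * h) (sym eq))))
      (V-≢ N y y′ eq))
    (≤-reflexive (interchange q (q ^ N))))
    where
    square : ∀ h → (1ℚ - h) * (1ℚ - h) ≡ 1ℚ - h - h + h * 0ℚ + h * h
    square = solve-∀ ℚ-ring
    interchange : ∀ a b → (a * a) * (b * b) ≡ (a * b) * (a * b)
    interchange = solve-∀ ℚ-ring

  V-≡ : ∀ N y y′ → δ y y′ ≡ 1ℚ → V N y y′ ≡ q ^ N
  V-≡ zero    y y′ _  = E-const r (1ℚ * 1ℚ)
  V-≡ (suc N) y y′ eq = trans (V-suc N y y′) (cong₂ _*_
    (trans (cong (λ e → 1ℚ - h - h + h * e) eq) (cancel h)) (V-≡ N y y′ eq))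
    where
    cancel : ∀ h → 1ℚ - h - h + h * 1ℚ ≡ 1ℚ - h
    cancel = solve-∀ ℚ-ring

  0≤qᴺ : ∀ N → 0ℚ ≤ q ^ N
  0≤qᴺ N = ^-nonNeg N 0≤q

  V≤ : ∀ N y y′ → V N y y′ ≤ q ^ N * q ^ N + q ^ N * δ y y′
  V≤ N y y′ with δ-01 y y′
  ... | inj₁ eq = ≤-trans (V-≢ N y y′ eq) (≤-reflexive
          (trans (sym (trans (cong (q ^ N * q ^ N +_) (*-zeroʳ (q ^ N))) (+-identityʳ _))) (cong (λ e → q ^ N * q ^ N + q ^ N * e) (sym eq))))
  ... | inj₂ eq = ≤-trans (≤-reflexive (V-≡ N y y′ eq)) (≤-by (q ^ N * q ^ N) (0≤² (q ^ N))
          (trans (cong (λ e → q ^ N * q ^ N + q ^ N * e) eq) (trans (cong (q ^ N * q ^ N +_) (*-identityʳ (q ^ N))) (+-comm _ (q ^ N)))))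

  -- Write G² as a double average over pairs of strings. Off the diagonal, negative correlation
  -- gives the squared mean; the diagonal has weight `h` and adds the second summand.
  E-G² : ∀ N → E (λ x → G N x * G N x) ≤ q ^ N * q ^ N + q ^ N * h
  E-G² N = ≤-trans (≤-reflexive unfold) (≤-trans (E-mono λ y → E-mono λ y′ → V≤ N y′ y)
    (≤-reflexive (trans (E-cong λ y → trans (E-+ (λ _ → q ^ N * q ^ N) (λ y′ → q ^ N * δ y′ y))
        (cong₂ _+_ (E-const m (q ^ N * q ^ N)) (trans (E-δ (λ _ → q ^ N) y) (*-comm h (q ^ N)))))
      (E-const m (q ^ N * q ^ N + q ^ N * h)))))
    where
    unfold : E (λ x → G N x * G N x) ≡ E (λ y → E (λ y′ → V N y′ y))
    unfold = trans
      (E-cong λ x → trans (sym (E-*ˡ (G N x) (λ y → miss N y x))) (E-cong λ y → sym (E-*ʳ (miss N y x) (λ y′ → miss N y′ x))))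
      (trans (E-swap (λ x y → E (λ y′ → miss N y′ x * miss N y x)))
             (E-cong λ y → E-swap (λ x y′ → miss N y′ x * miss N y x)))

  bernoulli : ∀ k → 1ℚ - ι k * h ≤ q ^ k
  bernoulli zero    = ≤-reflexive (l h)
    where
    l : ∀ h → 1ℚ - 0ℚ * h ≡ 1ℚ
    l = solve-∀ ℚ-ring
  bernoulli (suc k) = ≤-trans
    (≤-by (ι k * (h * h)) (0≤* (ι-nonNeg k) (0≤² h))
      (trans (l (ι k) h) (cong (λ i → 1ℚ - i * h + ι k * (h * h)) (sym (ι-suc k)))))
    (*-monoˡ 0≤q (bernoulli k))
    where
    l : ∀ k h → (1ℚ - h) * (1ℚ - k * h) ≡ 1ℚ - (1ℚ + k) * h + k * (h * h)
    l = solve-∀ ℚ-ring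

  module _ (N : ℕ) (M ν : ℚ) (0≤M : 0ℚ ≤ M) (Mh≡1 : M * h ≡ 1ℚ) (0≤ν : 0ℚ ≤ ν) (μν≡1 : q ^ N * ν ≡ 1ℚ)
           (Mμ≤½ : M * q ^ N ≤ ½) (1≤4Mμ : 1ℚ ≤ ι 4 * (M * q ^ N)) where

    private
      μ : ℚ
      μ = q ^ N
      0≤μ : 0ℚ ≤ μ
      0≤μ = 0≤qᴺ N
      f : Cube (length N) → Bool
      f = surjective N

    -- Markov's inequality pointwise: `M * G N x` counts the missing strings, so it is at least 1 as
    -- soon as `f` fails.
    1-MG≤f : ∀ x → 1ℚ - M * G N x ≤ bitℚ (f x)
    1-MG≤f x with f x in eq
    ... | true  = ≤-by (M * G N x) (0≤* 0≤M (E-nonNeg λ y → 01-nonNeg (miss-01 N y x))) (l (M * G N x))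
      where
      l : ∀ a → 1ℚ ≡ 1ℚ - a + a
      l = solve-∀ ℚ-ring
    ... | false = ≤-by (M * (G N x - h)) (0≤* 0≤M (0≤-diff (¬surjective⇒h≤G N x eq)))
                    (sym (trans (l M (G N x) h) (cong (1ℚ -_) Mh≡1)))
      where
      l : ∀ M g h → 1ℚ - M * g + M * (g - h) ≡ 1ℚ - M * h
      l = solve-∀ ℚ-ring

    ½≤E-f : ½ ≤ E (λ x → bitℚ (f x))
    ½≤E-f = ≤-trans
      (≤-by (½ - M * μ) (0≤-diff Mμ≤½) (l (M * μ)))
      (≤-trans (≤-reflexive (sym (trans (E-- (λ _ → 1ℚ) (λ x → M * G N x)) (cong₂ _-_ (E-const (length N) 1ℚ) (trans (E-*ˡ M (G N)) (cong (M *_) (E-G N)))))))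
               (E-mono 1-MG≤f))
      where
      l : ∀ a → 1ℚ - a ≡ ½ + (½ - a)
      l = solve-∀ ℚ-ring

    module _ (d : ℕ) where
      κ : ℚ
      κ = ι 2 * (ι d * h)

      0≤dh : 0ℚ ≤ ι d * h
      0≤dh = 0≤* (ι-nonNeg d) 0≤h

      trivialTest : 1ℚ ≤ κ → Test f d κ
      trivialTest 1≤κ = record
        { h = λ _ → 1ℚ
        ; E-hf = ≤-trans ½≤E-f (≤-reflexive (E-cong λ x → sym (*-identityˡ (bitℚ (f x)))))
        ; E-hh = ≤-trans (≤-reflexive (E-const (length N) (1ℚ * 1ℚ))) (toWitness {a? = 1ℚ * 1ℚ ≤? ι 4} _)
        ; E-Ch≤ = λ C _ → ≤-trans (≤-reflexive (E-C C)) (1≤κ* C)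
        ; -E-Ch≤ = λ C _ → ≤-trans (≤-by (E (λ x → termℚ C x * 1ℚ) + ½^ ∣ C ∣ₜ)
            (0≤+ (E-nonNeg λ x → 0≤* (01-nonNeg (termℚ-01 C x)) 0≤1) (½^-nonNeg ∣ C ∣ₜ)) (l (E (λ x → termℚ C x * 1ℚ)) (½^ ∣ C ∣ₜ)))
            (1≤κ* C)
        }
        where
        E-C : ∀ C → E (λ x → termℚ C x * 1ℚ) ≡ ½^ ∣ C ∣ₜ
        E-C C = trans (E-cong λ x → *-identityʳ (termℚ C x)) (E-termℚ C)
        1≤κ* : ∀ C → ½^ ∣ C ∣ₜ ≤ κ * ½^ ∣ C ∣ₜ
        1≤κ* C = subst (_≤ κ * ½^ ∣ C ∣ₜ) (*-identityˡ _) (*-monoʳ-≤-nonNeg (½^ ∣ C ∣ₜ) {{ℚ.nonNegative (½^-nonNeg ∣ C ∣ₜ)}} 1≤κ)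
        l : ∀ e a → a ≡ ℚ.- e + (e + a)
        l = solve-∀ ℚ-ring

      g : Cube (length N) → ℚ
      g x = 1ℚ - ν * G N x

      E-gf : ½ ≤ E (λ x → g x * bitℚ (f x))
      E-gf = ≤-trans ½≤E-f (≤-reflexive (E-cong eq))
        where
        l : ∀ ν → 1ℚ ≡ (1ℚ - ν * 0ℚ) * 1ℚ
        l = solve-∀ ℚ-ring
        eq : ∀ x → bitℚ (f x) ≡ g x * bitℚ (f x)
        eq x with f x in fx
        ... | true  = trans (l ν) (cong (λ a → (1ℚ - ν * a) * 1ℚ) (sym (surjective⇒G≡0 N x fx)))
        ... | false = sym (*-zeroʳ (g x))

      -- As `G` has mean `μ`, the left side is Var(G)/μ² ≤ h/μ = 1/(Mμ). Multiplying by `1≤4Mμ`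
      -- takes the place of a division.
      E-gg : E (λ x → g x * g x) ≤ ι 4
      E-gg = ≤-trans (≤-reflexive (trans (E-cong λ x → expand ν (G N x)) E-expand))
        (≤-trans (+-monoʳ-≤ (1ℚ - ι 2 * ν * μ) (*-monoˡ (0≤² ν) (E-G² N)))
        (≤-trans (≤-reflexive (trans (factor-out ν μ h) (trans (cong (λ a → 1ℚ - ι 2 * a + a * a + a * (ν * h)) μν≡1) (simplify (ν * h)))))
        (≤-trans (≤-reflexive (sym (*-identityˡ (ν * h))))
        (≤-trans (*-monoʳ-≤-nonNeg (ν * h) {{ℚ.nonNegative (0≤* 0≤ν 0≤h)}} 1≤4Mμ)
        (≤-reflexive (trans (regroup M μ ν h) (trans (cong₂ (λ a b → ι 4 * (a * b)) Mh≡1 μν≡1) refl)))))))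
        where
        expand : ∀ ν g → (1ℚ - ν * g) * (1ℚ - ν * g) ≡ 1ℚ - ι 2 * ν * g + ν * ν * (g * g)
        expand = solve-∀ ℚ-ring
        E-expand : E (λ x → 1ℚ - ι 2 * ν * G N x + ν * ν * (G N x * G N x)) ≡ 1ℚ - ι 2 * ν * μ + ν * ν * E (λ x → G N x * G N x)
        E-expand = trans (E-+ (λ x → 1ℚ - ι 2 * ν * G N x) (λ x → ν * ν * (G N x * G N x)))
          (cong₂ _+_ (trans (E-- (λ _ → 1ℚ) (λ x → ι 2 * ν * G N x))
                       (cong₂ _-_ (E-const (length N) 1ℚ) (trans (E-*ˡ (ι 2 * ν) (G N)) (cong (ι 2 * ν *_) (E-G N)))))
                     (E-*ˡ (ν * ν) (λ x → G N x * G N x)))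
        factor-out : ∀ ν μ h → 1ℚ - ι 2 * ν * μ + ν * ν * (μ * μ + μ * h) ≡ 1ℚ - ι 2 * (μ * ν) + (μ * ν) * (μ * ν) + (μ * ν) * (ν * h)
        factor-out = solve-∀ ℚ-ring
        simplify : ∀ a → 1ℚ - ι 2 * 1ℚ + 1ℚ * 1ℚ + 1ℚ * a ≡ a
        simplify = solve-∀ ℚ-ring
        regroup : ∀ M μ ν h → ι 4 * (M * μ) * (ν * h) ≡ ι 4 * ((M * h) * (μ * ν))
        regroup = solve-∀ ℚ-ring

      -- Exchanging the averages over `x` and `y` leaves one task: to show that the mean of `W N C`
      -- over `y` is close to its value under independence, μ · ½^∣C∣.
      E-Cg : ∀ C → E (λ x → termℚ C x * g x) ≡ ½^ ∣ C ∣ₜ - ν * E (W N C)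
      E-Cg C = trans (E-cong λ x → expand (termℚ C x) ν (G N x))
        (trans (E-- (termℚ C) (λ x → ν * (termℚ C x * G N x)))
        (cong₂ _-_ (E-termℚ C) (trans (E-*ˡ ν (λ x → termℚ C x * G N x)) (cong (ν *_)
          (trans (E-cong λ x → sym (E-*ˡ (termℚ C x) (λ y → miss N y x))) (E-swap (λ x y → termℚ C x * miss N y x)))))))
        where
        expand : ∀ t ν g → t * (1ℚ - ν * g) ≡ t - ν * (t * g)
        expand = solve-∀ ℚ-ring

      module _ (κ≤1 : κ ≤ 1ℚ) (C : Term (length N)) (∣C∣≤d : ∣ C ∣ₜ ℕ.≤ d) where
        open Bounds (bounds N C)
        private
          A : ℚ
          A = ½^ ∣ C ∣ₜ
          0≤A : 0ℚ ≤ A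
          0≤A = ½^-nonNeg ∣ C ∣ₜ
          c≤d : ι ∣ C ∣ₜ * h ≤ ι d * h
          c≤d = *-monoʳ-≤-nonNeg h {{ℚ.nonNegative 0≤h}} (ι-mono ∣C∣≤d)
          dh≤1 : ι d * h ≤ 1ℚ
          dh≤1 = ≤-trans (≤-by (ι d * h) 0≤dh (l (ι d * h))) κ≤1
            where
            l : ∀ a → ι 2 * a ≡ a + a
            l = solve-∀ ℚ-ring

        W-lower : μ * ((1ℚ - ι d * h) * A) ≤ E (W N C)
        W-lower = ≤-trans
          (*-mono 0≤μ (0≤* (0≤-diff dh≤1) 0≤A) qᴺ≤Q
            (≤-trans (≤-by ((ι d * h - ι ∣ C ∣ₜ * h) * A) (0≤* (0≤-diff c≤d) 0≤A) (l (ι d * h) (ι ∣ C ∣ₜ * h) A))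
                     (+-monoʳ-≤ A (neg-antimono-≤ E-D))))
          (≤-trans (≤-reflexive (sym (trans (E-*ˡ Q (λ y → A - D y)) (cong (Q *_) (trans (E-- (λ _ → A) D) (cong (_- E D) (E-const m A)))))))
                   (E-mono lower))
          where
          l : ∀ d c a → a - c * a ≡ (1ℚ - d) * a + (d - c) * a
          l = solve-∀ ℚ-ring

        -- Bernoulli gives `q ^ ∣ C ∣ₜ` ≥ 1 - e with e = d/M, and 1/(1 - e) ≤ 1 + 2e for e ≤ ½. This
        -- is where the factor 2 in `κ` comes from, and why `κ` ≤ 1 is assumed.
        Q≤ : Q ≤ (1ℚ + κ) * μ
        Q≤ = ≤-trans
          (≤-by (ι d * h * (1ℚ - κ) * Q) (0≤* (0≤* 0≤dh (0≤-diff κ≤1)) 0≤Q) (l (ι d * h) Q))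
          (≤-trans (*-monoˡ 0≤1+κ (*-monoʳ-≤-nonNeg Q {{ℚ.nonNegative 0≤Q}} 1-dh≤qᶜ))
            (*-monoˡ 0≤1+κ q^∣C∣Q≤qᴺ))
          where
          0≤1+κ : 0ℚ ≤ 1ℚ + κ
          0≤1+κ = 0≤+ 0≤1 (0≤* (ι-nonNeg 2) 0≤dh)
          l : ∀ e Q → (1ℚ + ι 2 * e) * ((1ℚ - e) * Q) ≡ Q + e * (1ℚ - ι 2 * e) * Q
          l = solve-∀ ℚ-ring
          l′ : ∀ e c → 1ℚ - c ≡ 1ℚ - e + (e - c)
          l′ = solve-∀ ℚ-ring
          1-dh≤qᶜ : 1ℚ - ι d * h ≤ q ^ ∣ C ∣ₜ
          1-dh≤qᶜ = ≤-trans (≤-by (ι d * h - ι ∣ C ∣ₜ * h) (0≤-diff c≤d) (l′ (ι d * h) (ι ∣ C ∣ₜ * h))) (bernoulli ∣ C ∣ₜ)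

        W-upper : E (W N C) ≤ (1ℚ + κ) * μ * A
        W-upper = ≤-trans (E-mono upper) (≤-trans (≤-reflexive (E-const m (Q * A)))
          (*-monoʳ-≤-nonNeg A {{ℚ.nonNegative 0≤A}} Q≤))

        E-Cg≤ : E (λ x → termℚ C x * g x) ≤ κ * A
        E-Cg≤ = ≤-trans (≤-reflexive (E-Cg C))
          (≤-trans (+-monoʳ-≤ A (neg-antimono-≤ (*-monoˡ 0≤ν W-lower)))
          (≤-by (ι d * h * A) (0≤* 0≤dh 0≤A)
            (trans (l (ι d * h) A) (trans (cong (λ a → A - a * ((1ℚ - ι d * h) * A) + ι d * h * A) (sym μν≡1)) (l′ A μ ν ((1ℚ - ι d * h) * A) (ι d * h * A))))))
          where
          l : ∀ e a → ι 2 * e * a ≡ a - 1ℚ * ((1ℚ - e) * a) + e * a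
          l = solve-∀ ℚ-ring
          l′ : ∀ a μ ν b c → a - μ * ν * b + c ≡ a - ν * (μ * b) + c
          l′ = solve-∀ ℚ-ring

        -E-Cg≤ : ℚ.- E (λ x → termℚ C x * g x) ≤ κ * A
        -E-Cg≤ = ≤-trans (≤-reflexive (cong ℚ.-_ (E-Cg C)))
          (≤-trans (neg-antimono-≤ (+-monoʳ-≤ A (neg-antimono-≤ (*-monoˡ 0≤ν W-upper))))
          (≤-reflexive (trans (l A ν μ κ) (trans (cong (λ a → (1ℚ + κ) * a * A - A) μν≡1) (l′ A κ)))))
          where
          l : ∀ a ν μ k → ℚ.- (a - ν * ((1ℚ + k) * μ * a)) ≡ (1ℚ + k) * (μ * ν) * a - a
          l = solve-∀ ℚ-ring
          l′ : ∀ a k → (1ℚ + k) * 1ℚ * a - a ≡ k * a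
          l′ = solve-∀ ℚ-ring

      test : Test f d κ
      test with ≤-total 1ℚ κ
      ... | inj₁ 1≤κ = trivialTest 1≤κ
      ... | inj₂ κ≤1 = record
        { h = g ; E-hf = E-gf ; E-hh = E-gg ; E-Ch≤ = E-Cg≤ κ≤1 ; -E-Ch≤ = -E-Cg≤ κ≤1 }

-- The circuit

private variable
  s k : ℕ

and-tabulate : {A : Set} (g : A → Bool) (p : Fin k → A) →
  and (List.map g (List.tabulate p)) ≡ ⋀ (λ i → g (p i))
and-tabulate {zero}  g p = refl
and-tabulate {suc k} g p = cong (g (p zero) ∧_) (and-tabulate g (p ∘ suc))

or-tabulate : {A : Set} (g : A → Bool) (p : Fin k → A) →
  or (List.map g (List.tabulate p)) ≡ ⋁ (λ i → g (p i))
or-tabulate {zero}  g p = refl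
or-tabulate {suc k} g p = cong (g (p zero) ∨_) (or-tabulate g (p ∘ suc))

max-tabulate : {A : Set} (g : A → ℕ) (p : Fin k → A) {b : ℕ} → (∀ i → g (p i) ℕ.≤ b) →
  foldr _⊔_ 0 (List.map g (List.tabulate p)) ℕ.≤ b
max-tabulate {zero}  g p g≤b = ℕ.z≤n
max-tabulate {suc k} g p g≤b = ℕ.⊔-lub (g≤b zero) (max-tabulate g (p ∘ suc) (g≤b ∘ suc))

mapGate : ∀ {v w} → (Fin v → Fin w) → Gate v → Gate w
mapGate ρ (AND js) = AND (List.map ρ js)
mapGate ρ (OR js)  = OR (List.map ρ js)
mapGate ρ (NOT j)  = NOT (ρ j)

map-lookup-∘ : ∀ {A : Set} {v w} (ρ : Fin v → Fin w) (xs : Vec A v) (ys : Vec A w) →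
  (∀ i → lookup ys (ρ i) ≡ lookup xs i) → ∀ js → List.map (lookup ys) (List.map ρ js) ≡ List.map (lookup xs) js
map-lookup-∘ ρ xs ys eq js = trans (sym (map-∘ js)) (map-cong eq js)

gateValue-map : ∀ {v w} (ρ : Fin v → Fin w) (xs : Vec Bool v) (ys : Vec Bool w) →
  (∀ i → lookup ys (ρ i) ≡ lookup xs i) → ∀ g → gateValue (mapGate ρ g) ys ≡ gateValue g xs
gateValue-map ρ xs ys eq (AND js) = cong and (map-lookup-∘ ρ xs ys eq js)
gateValue-map ρ xs ys eq (OR js)  = cong or (map-lookup-∘ ρ xs ys eq js)
gateValue-map ρ xs ys eq (NOT j)  = cong not (eq j)

gateDepth-map : ∀ {v w} (ρ : Fin v → Fin w) (xs : Vec ℕ v) (ys : Vec ℕ w) →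
  (∀ i → lookup ys (ρ i) ≡ lookup xs i) → ∀ g → gateDepth (mapGate ρ g) ys ≡ gateDepth g xs
gateDepth-map ρ xs ys eq (AND js) = cong (suc ∘ foldr _⊔_ 0) (map-lookup-∘ ρ xs ys eq js)
gateDepth-map ρ xs ys eq (OR js)  = cong (suc ∘ foldr _⊔_ 0) (map-lookup-∘ ρ xs ys eq js)
gateDepth-map ρ xs ys eq (NOT j)  = eq j

old : ∀ k → Fin (s ℕ.+ n) → Fin ((k ℕ.+ s) ℕ.+ n)
old zero    i = i
old (suc k) i = suc (old k i)

new : Fin k → Fin ((k ℕ.+ s) ℕ.+ n)
new zero    = zero
new (suc i) = suc (new i)

-- All gates of a layer read wires of `gs` only, so a layer raises the depth by at most one. Wires
-- are numbered from the newest backwards, hence the renumbering by `old k`.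
layer : Gates n s → (Fin k → Gate (s ℕ.+ n)) → Gates n (k ℕ.+ s)
layer {k = zero}  gs g = gs
layer {k = suc k} gs g = layer gs (g ∘ suc) ▷ mapGate (old k) (g zero)

module _ {n s} (gs : Gates n s) (x : Cube n) where

  value-old : ∀ {k} (g : Fin k → Gate (s ℕ.+ n)) w →
    lookup (values (layer gs g) x) (old k w) ≡ lookup (values gs x) w
  value-old {zero}  g w = refl
  value-old {suc k} g w = value-old (g ∘ suc) w

  value-new : ∀ {k} (g : Fin k → Gate (s ℕ.+ n)) i →
    lookup (values (layer gs g) x) (new i) ≡ gateValue (g i) (values gs x)
  value-new {suc k} g zero    = gateValue-map (old k) (values gs x) (values (layer gs (g ∘ suc)) x) (value-old (g ∘ suc)) (g zero)
  value-new {suc k} g (suc i) = value-new (g ∘ suc) i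

module _ {n s} (gs : Gates n s) where

  depth-old : ∀ {k} (g : Fin k → Gate (s ℕ.+ n)) w →
    lookup (depths (layer gs g)) (old k w) ≡ lookup (depths gs) w
  depth-old {zero}  g w = refl
  depth-old {suc k} g w = depth-old (g ∘ suc) w

  depth-new : ∀ {k} (g : Fin k → Gate (s ℕ.+ n)) i →
    lookup (depths (layer gs g)) (new i) ≡ gateDepth (g i) (depths gs)
  depth-new {suc k} g zero    = gateDepth-map (old k) (depths gs) (depths (layer gs (g ∘ suc))) (depth-old (g ∘ suc)) (g zero)
  depth-new {suc k} g (suc i) = depth-new (g ∘ suc) i

module SurjectivityCircuit (m r N : ℕ) where
  open Blocks m r using (length)
  open Surjectivity m r

  private
    ℓ K : ℕ
    ℓ = length N
    K = List.length images

  negations : Gates ℓ (ℓ ℕ.+ 0)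
  negations = layer inputs NOT

  literalWire : Bool → Fin ℓ → Fin ((ℓ ℕ.+ 0) ℕ.+ ℓ)
  literalWire true  i = old {s = 0} ℓ i
  literalWire false i = new {s = 0} i

  matchGate : Fin N × Fin K → Gate ((ℓ ℕ.+ 0) ℕ.+ ℓ)
  matchGate (j , k) = AND (List.tabulate λ i → literalWire (lookup (List.lookup images k) i) (pos N j i))

  matches : Gates ℓ (N ℕ.* K ℕ.+ (ℓ ℕ.+ 0))
  matches = layer negations (matchGate ∘ remQuot {N} K)

  matchWire : Fin N → Fin K → Fin ((N ℕ.* K ℕ.+ (ℓ ℕ.+ 0)) ℕ.+ ℓ)
  matchWire j k = new {s = ℓ ℕ.+ 0} (combine j k)

  hitGate : Fin K → Gate ((N ℕ.* K ℕ.+ (ℓ ℕ.+ 0)) ℕ.+ ℓ)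
  hitGate k = OR (List.tabulate λ j → matchWire j k)

  hits : Gates ℓ (K ℕ.+ (N ℕ.* K ℕ.+ (ℓ ℕ.+ 0)))
  hits = layer matches hitGate

  hitWire : Fin K → Fin ((K ℕ.+ (N ℕ.* K ℕ.+ (ℓ ℕ.+ 0))) ℕ.+ ℓ)
  hitWire = new {s = N ℕ.* K ℕ.+ (ℓ ℕ.+ 0)}

  -- An AND over all strings, of an OR over all blocks, of an AND over the bits of a block. The
  -- literals come from one layer of NOT gates, which costs no depth.
  surjectivityCircuit : Circuit ℓ
  surjectivityCircuit = circuit _ (hits ▷ AND (List.tabulate hitWire)) zero

  run-surjectivity : ∀ x → run surjectivityCircuit x ≡ surjective N x
  run-surjectivity x = trans
    (and-tabulate (lookup (values hits x)) hitWire)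
    (⋀-cong λ k → trans (value-new matches x hitGate k)
      (trans (or-tabulate (lookup (values matches x)) (λ j → matchWire j k))
        (⋁-cong λ j → match-value j k)))
    where
    literal-value : ∀ b i → lookup (values negations x) (literalWire b i) ≡ literal b (lookup x i)
    literal-value true  i = value-old inputs x NOT i
    literal-value false i = value-new inputs x NOT i

    match-value : ∀ j k → lookup (values matches x) (matchWire j k) ≡
      ⋀ λ i → literal (lookup (List.lookup images k) i) (lookup x (pos N j i))
    match-value j k = trans (value-new negations x (matchGate ∘ remQuot {N} K) (combine j k))
      (trans (cong (λ jk → gateValue (matchGate jk) (values negations x)) (remQuot-combine {N} {K} j k))
      (trans (and-tabulate (lookup (values negations x)) (λ i → literalWire (lookup (List.lookup images k) i) (pos N j i)))
        (⋀-cong λ i → literal-value (lookup (List.lookup images k) i) (pos N j i))))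

  depth-surjectivity : depth surjectivityCircuit ℕ.≤ 3
  depth-surjectivity = ℕ.s≤s (max-tabulate (lookup (depths hits)) hitWire λ k →
    subst (ℕ._≤ 2) (sym (depth-new matches hitGate k))
      (ℕ.s≤s (max-tabulate (lookup (depths matches)) (λ j → matchWire j k) λ j → match-depth j k)))
    where
    literal-depth : ∀ b i → lookup (depths negations) (literalWire b i) ℕ.≤ 0
    literal-depth true  i = ℕ.≤-reflexive (trans (depth-old inputs NOT i) (lookup-replicate i 0))
    literal-depth false i = ℕ.≤-reflexive (trans (depth-new inputs NOT i) (lookup-replicate i 0))

    match-depth : ∀ j k → lookup (depths matches) (matchWire j k) ℕ.≤ 1
    match-depth j k = subst (ℕ._≤ 1)
      (sym (trans (depth-new negations (matchGate ∘ remQuot {N} K) (combine j k))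
                  (cong (λ jk → gateDepth (matchGate jk) (depths negations)) (remQuot-combine {N} {K} j k))))
      (ℕ.s≤s (max-tabulate (lookup (depths negations)) (λ i → literalWire (lookup (List.lookup images k) i) (pos N j i))
        λ i → literal-depth (lookup (List.lookup images k) i) (pos N j i)))

-- The parameters m and N

-- The function and its circuit must exist for every `n`, whereas the quantitative claims are
-- asymptotic. The threshold 4 = 2¹ · 1 · 2 is the least length with room for m = 1. The constant is
-- 24 = 2 · 12, from `κ` = 2d/M and n ≤ 12 M log² n.
record Hard (n : ℕ) : Set where
  field
    function : Cube n → Bool
    C        : Circuit n
    run≡     : ∀ x → run C x ≡ function x
    depth≤3  : depth C ℕ.≤ 3
    size≤n³  : 4 ℕ.≤ n → size C ℕ.≤ n ℕ.^ 3
    test     : 4 ℕ.≤ n → ∀ d → Σ[ κ ∈ ℚ ] (Test function d κ ×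
                 0ℚ ≤ κ × κ * ι n ≤ ι 24 * (ι d * ι (⌊log₂ n ⌋ ℕ.^ 2)))

-- A crossing point found by searching down from `K`, with no monotonicity of `P` required. Both `m`
-- and the number of blocks are chosen this way.
lastTrue : (P : ℕ → Set) → (∀ k → Dec (P k)) → P 0 → ∀ K → ¬ P K →
  Σ[ k ∈ ℕ ] (k ℕ.< K × P k × ¬ P (suc k))
lastTrue P P? P0 zero    ¬PK = ⊥-elim (¬PK P0)
lastTrue P P? P0 (suc K) ¬PK with P? K
... | yes PK = K , ℕ.≤-refl , PK , ¬PK
... | no ¬PK′ with lastTrue P P? P0 K ¬PK′
...   | k , k<K , Pk , ¬P = k , ℕ.m<n⇒m<1+n k<K , Pk , ¬P

ι2^*½^ : ∀ m → ι (2 ℕ.^ m) * ½^ m ≡ 1ℚ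
ι2^*½^ zero    = refl
ι2^*½^ (suc m) = trans (cong (_* ½^ (suc m)) (ι-* 2 (2 ℕ.^ m))) (trans (regroup (ι (2 ℕ.^ m)) (½^ m)) (ι2^*½^ m))
  where
  regroup : ∀ a b → ι 2 * a * (½ * b) ≡ a * b
  regroup = solve-∀ ℚ-ring

^≤½^ : ∀ k → 0ℚ ≤ x → x ≤ ½ → x ^ k ≤ ½^ k
^≤½^ zero    0≤x x≤½ = ≤-refl
^≤½^ (suc k) 0≤x x≤½ = *-mono 0≤x (^-nonNeg k 0≤x) x≤½ (^≤½^ k 0≤x x≤½)

module _ (m : ℕ) where
  private
    h q M : ℚ
    h = ½^ m
    q = 1ℚ - h
    M = ι (2 ℕ.^ m)
    0≤h : 0ℚ ≤ h
    0≤h = ½^-nonNeg m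
    0≤q : 0ℚ ≤ q
    0≤q = 0≤-diff (½^≤1 m)

  -- A rational substitute for (1 - h)ᵏ ≤ exp(-kh). At k = 2ᵐ it yields qᵏ ≤ ½, which is all that is
  -- needed of the exponential.
  q^k[1+kh]≤1 : ∀ k → q ^ k * (1ℚ + ι k * h) ≤ 1ℚ
  q^k[1+kh]≤1 zero    = ≤-reflexive (l h)
    where
    l : ∀ h → 1ℚ * (1ℚ + 0ℚ * h) ≡ 1ℚ
    l = solve-∀ ℚ-ring
  q^k[1+kh]≤1 (suc k) = ≤-trans
    (≤-by (q ^ k * ((1ℚ + ι k) * (h * h))) (0≤* (^-nonNeg k 0≤q) (0≤* (0≤+ 0≤1 (ι-nonNeg k)) (0≤² h)))
      (trans (l (q ^ k) (ι k) h) (cong (λ i → q * q ^ k * (1ℚ + i * h) + q ^ k * ((1ℚ + ι k) * (h * h))) (sym (ι-suc k)))))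
    (q^k[1+kh]≤1 k)
    where
    l : ∀ p k h → p * (1ℚ + k * h) ≡ (1ℚ - h) * p * (1ℚ + (1ℚ + k) * h) + p * ((1ℚ + k) * (h * h))
    l = solve-∀ ℚ-ring

  q^2^m≤½ : q ^ (2 ℕ.^ m) ≤ ½
  q^2^m≤½ = ≤-trans (≤-reflexive (trans (l (q ^ (2 ℕ.^ m))) (cong (λ a → ½ * (q ^ (2 ℕ.^ m) * (1ℚ + a))) (sym (ι2^*½^ m)))))
    (*-monoˡ {½} 0≤½ (q^k[1+kh]≤1 (2 ℕ.^ m)))
    where
    l : ∀ a → a ≡ ½ * (a * (1ℚ + 1ℚ))
    l = solve-∀ ℚ-ring

  -- Each batch of 2ᵐ blocks halves the expected number of missing strings, so `suc m` batches bring
  -- it from 2ᵐ down to ½.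
  Mq^K≤½ : M * q ^ (2 ℕ.^ m ℕ.* suc m) ≤ ½
  Mq^K≤½ = ≤-trans
    (*-monoˡ (ι-nonNeg (2 ℕ.^ m)) (≤-trans (≤-reflexive (sym (^-assocʳ q (2 ℕ.^ m) (suc m))))
      (^≤½^ (suc m) (^-nonNeg (2 ℕ.^ m) 0≤q) q^2^m≤½)))
    (≤-reflexive (trans (l M h) (cong (½ *_) (ι2^*½^ m))))
    where
    l : ∀ M h → M * (½ * h) ≡ ½ * (M * h)
    l = solve-∀ ℚ-ring

  1≤M : 1ℚ ≤ M
  1≤M = ι-mono {1} {2 ℕ.^ m} (ℕ.m^n>0 2 m)

  q≥½ : 1 ℕ.≤ m → ½ ≤ q
  q≥½ 1≤m = ≤-by (½ - h) (0≤-diff (h≤½ 1≤m)) (l h)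
    where
    l : ∀ h → 1ℚ - h ≡ ½ + (½ - h)
    l = solve-∀ ℚ-ring
    h≤½ : ∀ {m} → 1 ℕ.≤ m → ½^ m ≤ ½
    h≤½ {suc m} _ = subst (½ * ½^ m ≤_) (*-identityʳ ½) (*-monoˡ {½} 0≤½ (½^≤1 m))

  -- One more block multiplies the expectation by q ≥ ½, so crossing ½ cannot overshoot ¼.
  Mq^1+k≥¼ : ∀ k → ½ < M * q ^ k → 1 ℕ.≤ m → 1ℚ ≤ ι 4 * (M * q ^ suc k)
  Mq^1+k≥¼ k ½<Mq^k 1≤m = ≤-trans (*-monoˡ {ι 4} {½ * ½} (ι-nonNeg 4) (*-mono 0≤½ 0≤½ (q≥½ 1≤m) (<⇒≤ ½<Mq^k)))
    (≤-reflexive (cong (ι 4 *_) (l q M (q ^ k))))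
    where
    l : ∀ a b c → a * (b * c) ≡ b * (a * c)
    l = solve-∀ ℚ-ring

  blockCount : Σ[ N ∈ ℕ ] (N ℕ.≤ 2 ℕ.^ m ℕ.* suc m × M * q ^ N ≤ ½ × (1 ℕ.≤ m → 1ℚ ≤ ι 4 * (M * q ^ N)))
  blockCount = fromLast (lastTrue (λ k → ½ < M * q ^ k) (λ k → ½ <? M * q ^ k) large (2 ℕ.^ m ℕ.* suc m)
    (λ lt → <-irrefl refl (<-≤-trans lt Mq^K≤½)))
    where
    large : ½ < M * 1ℚ
    large = <-≤-trans (toWitness {a? = ½ <? 1ℚ} _) (subst (1ℚ ≤_) (sym (*-identityʳ M)) 1≤M)
    fromLast : Σ[ k ∈ ℕ ] (k ℕ.< 2 ℕ.^ m ℕ.* suc m × ½ < M * q ^ k × ¬ (½ < M * q ^ suc k)) →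
      Σ[ N ∈ ℕ ] (N ℕ.≤ 2 ℕ.^ m ℕ.* suc m × M * q ^ N ≤ ½ × (1 ℕ.≤ m → 1ℚ ≤ ι 4 * (M * q ^ N)))
    fromLast (k , k<K , ½<Mq^k , ¬½<Mq^1+k) = suc k , k<K , ≮⇒≥ ¬½<Mq^1+k , Mq^1+k≥¼ k ½<Mq^k

length-cubes : ∀ m → List.length (cubes m) ≡ 2 ℕ.^ m
length-cubes zero    = refl
length-cubes (suc m) = trans (length-++ (List.map (true ∷_) (cubes m)))
  (cong₂ ℕ._+_ (trans (length-map _ (cubes m)) (length-cubes m))
    (trans (length-++ (List.map (false ∷_) (cubes m))) (cong (ℕ._+ 0) (trans (length-map _ (cubes m)) (length-cubes m)))))
  where open import Data.Vec.Base using (_∷_)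

length-blocks : ∀ m r N → Blocks.length m r N ≡ N ℕ.* m ℕ.+ r
length-blocks m r zero    = refl
length-blocks m r (suc N) = trans (cong (m ℕ.+_) (length-blocks m r N)) (sym (ℕ.+-assoc m (N ℕ.* m) r))

-- The output gate and the three layers below it have at most n² gates each, and 4n² ≤ n³ once n ≥
-- 4.
circuitSize≤ : ∀ n K N → 4 ℕ.≤ n → K ℕ.≤ n → N ℕ.≤ n →
  suc (K ℕ.+ (N ℕ.* K ℕ.+ (n ℕ.+ 0))) ℕ.≤ n ℕ.^ 3
circuitSize≤ n K N 4≤n K≤n N≤n = begin
  suc (K ℕ.+ (N ℕ.* K ℕ.+ (n ℕ.+ 0)))
    ≤⟨ ℕ.+-mono-≤ 1≤n² (ℕ.+-mono-≤ (ℕ.≤-trans K≤n n≤n²) (ℕ.+-mono-≤ (ℕ.*-mono-≤ N≤n K≤n) (ℕ.≤-trans (ℕ.≤-reflexive (ℕ.+-identityʳ n)) n≤n²))) ⟩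
  n ℕ.* n ℕ.+ (n ℕ.* n ℕ.+ (n ℕ.* n ℕ.+ n ℕ.* n))
    ≡⟨ four n ⟩
  4 ℕ.* (n ℕ.* n)
    ≤⟨ ℕ.*-monoˡ-≤ (n ℕ.* n) 4≤n ⟩
  n ℕ.* (n ℕ.* n)
    ≡⟨ cong (λ k → n ℕ.* (n ℕ.* k)) (sym (ℕ.*-identityʳ n)) ⟩
  n ℕ.^ 3 ∎
  where
  open ℕ.≤-Reasoning
  1≤n : 1 ℕ.≤ n
  1≤n = ℕ.≤-trans (s≤s z≤n) 4≤n
  n≤n² : n ℕ.≤ n ℕ.* n
  n≤n² = subst (ℕ._≤ n ℕ.* n) (ℕ.*-identityʳ n) (ℕ.*-monoʳ-≤ n 1≤n)
  1≤n² : 1 ℕ.≤ n ℕ.* n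
  1≤n² = ℕ.≤-trans 1≤n n≤n²
  four : ∀ n → n ℕ.* n ℕ.+ (n ℕ.* n ℕ.+ (n ℕ.* n ℕ.+ n ℕ.* n)) ≡ 4 ℕ.* (n ℕ.* n)
  four = ℕ-Solver.solve-∀

module _ (m N : ℕ)
         (Mμ≤½ : ι (2 ℕ.^ m) * (1ℚ - ½^ m) ^ N ≤ ½)
         (1≤4Mμ : 1 ℕ.≤ m → 1ℚ ≤ ι 4 * (ι (2 ℕ.^ m) * (1ℚ - ½^ m) ^ N)) where

  buildHard : ∀ {n} r → Blocks.length m r N ≡ n →
    (4 ℕ.≤ n → 1 ℕ.≤ m) → (4 ℕ.≤ n → 2 ℕ.^ m ℕ.≤ n) → N ℕ.* m ℕ.≤ n →
    (4 ℕ.≤ n → n ℕ.≤ 12 ℕ.* (2 ℕ.^ m ℕ.* ⌊log₂ n ⌋ ℕ.^ 2)) → Hard n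
  buildHard {n} r refl 1≤m 2^m≤n Nm≤n n≤ = record
    { function = surjective N
    ; C        = surjectivityCircuit
    ; run≡     = run-surjectivity
    ; depth≤3  = depth-surjectivity
    ; size≤n³  = λ 4≤n → circuitSize≤ n _ N 4≤n
        (subst (ℕ._≤ n) (sym (length-cubes m)) (2^m≤n 4≤n))
        (ℕ.≤-trans (subst (ℕ._≤ N ℕ.* m) (ℕ.*-identityʳ N) (ℕ.*-monoʳ-≤ N (1≤m 4≤n))) Nm≤n)
    ; test     = λ 4≤n d → ι 2 * (ι d * ½^ m) , testOf 4≤n d ,
        0≤* (ι-nonNeg 2) (0≤* (ι-nonNeg d) (½^-nonNeg m)) , κn≤ 4≤n d
    }
    where
    open Surjectivity m r
    open SurjectivityCircuit m r N

    μ M : ℚ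
    μ = (1ℚ - ½^ m) ^ N
    M = ι (2 ℕ.^ m)

    testOf : 4 ℕ.≤ n → ∀ d → Test (surjective N) d (ι 2 * (ι d * ½^ m))
    testOf 4≤n d = test N M ν (ι-nonNeg (2 ℕ.^ m)) (ι2^*½^ m) 0≤ν (*-inverseʳ μ {{μ≢0}}) Mμ≤½ (1≤4Mμ (1≤m 4≤n)) d
      where
      0<μ : 0ℚ < μ
      0<μ = ≰⇒> λ μ≤0 → <-irrefl refl (<-≤-trans (toWitness {a? = 0ℚ <? 1ℚ} _)
        (≤-trans (1≤4Mμ (1≤m 4≤n))
          (≤-trans (*-monoˡ (ι-nonNeg 4) (*-monoˡ (ι-nonNeg (2 ℕ.^ m)) μ≤0)) (≤-reflexive (l M)))))
        where
        l : ∀ M → ι 4 * (M * 0ℚ) ≡ 0ℚ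
        l = solve-∀ ℚ-ring
      μ-pos : ℚ.Positive μ
      μ-pos = ℚ.positive 0<μ
      μ≢0 : ℚ.NonZero μ
      μ≢0 = pos⇒nonZero μ {{μ-pos}}
      ν : ℚ
      ν = ℚ.1/_ μ {{μ≢0}}
      0≤ν : 0ℚ ≤ ν
      0≤ν = <⇒≤ (positive⁻¹ ν {{1/pos⇒pos μ {{μ-pos}}}})

    κn≤ : 4 ℕ.≤ n → ∀ d → ι 2 * (ι d * ½^ m) * ι n ≤ ι 24 * (ι d * ι (⌊log₂ n ⌋ ℕ.^ 2))
    κn≤ 4≤n d = ≤-trans
      (*-monoˡ (0≤* (ι-nonNeg 2) (0≤* (ι-nonNeg d) (½^-nonNeg m)))
        (≤-trans (ι-mono (n≤ 4≤n)) (≤-reflexive (trans (ι-* 12 (2 ℕ.^ m ℕ.* L²)) (cong (ι 12 *_) (ι-* (2 ℕ.^ m) L²))))))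
      (≤-reflexive (trans (l (ι d) (½^ m) M (ι L²)) (trans (cong (λ a → ι 24 * (a * (ι d * ι L²))) (ι2^*½^ m)) (cong (ι 24 *_) (*-identityˡ (ι d * ι L²))))))
      where
      L² : ℕ
      L² = ⌊log₂ n ⌋ ℕ.^ 2
      l : ∀ d h M L → ι 2 * (d * h) * (ι 12 * (M * L)) ≡ ι 24 * ((M * h) * (d * L))
      l = solve-∀ ℚ-ring

module _ (n m : ℕ)
         (fits  : 2 ℕ.^ m ℕ.* (m ℕ.* suc m) ℕ.≤ n)
         (¬fits : ¬ (2 ℕ.^ suc m ℕ.* (suc m ℕ.* suc (suc m)) ℕ.≤ n)) where

  Nm≤n : ∀ N → N ℕ.≤ 2 ℕ.^ m ℕ.* suc m → N ℕ.* m ℕ.≤ n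
  Nm≤n N N≤ = ℕ.≤-trans (ℕ.*-monoˡ-≤ m N≤) (ℕ.≤-trans (ℕ.≤-reflexive (l (2 ℕ.^ m) m)) fits)
    where
    l : ∀ a m → a ℕ.* suc m ℕ.* m ≡ a ℕ.* (m ℕ.* suc m)
    l = ℕ-Solver.solve-∀
  1≤m : 4 ℕ.≤ n → 1 ℕ.≤ m
  1≤m 4≤n = ℕ.n≢0⇒n>0 λ m≡0 → subst (λ m → ¬ (2 ℕ.^ suc m ℕ.* (suc m ℕ.* suc (suc m)) ℕ.≤ n)) m≡0 ¬fits 4≤n
  2^m≤n : 1 ℕ.≤ m → 2 ℕ.^ m ℕ.≤ n
  2^m≤n 1≤m = ℕ.≤-trans (subst (ℕ._≤ 2 ℕ.^ m ℕ.* (m ℕ.* suc m)) (ℕ.*-identityʳ (2 ℕ.^ m))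
    (ℕ.*-monoʳ-≤ (2 ℕ.^ m) (ℕ.*-mono-≤ 1≤m (s≤s z≤n)))) fits
  -- Since `suc m` no longer fits, n < 2 · 2ᵐ (m + 1)(m + 2), and the two factors are at most 2m and
  -- 3m. Since `m` does fit, 2ᵐ ≤ n, so m ≤ log n.
  n≤12·2ᵐ·log²n : 1 ℕ.≤ m → n ℕ.≤ 12 ℕ.* (2 ℕ.^ m ℕ.* ⌊log₂ n ⌋ ℕ.^ 2)
  n≤12·2ᵐ·log²n 1≤m = begin
    n
      ≤⟨ ℕ.<⇒≤ (ℕ.≰⇒> ¬fits) ⟩
    2 ℕ.^ suc m ℕ.* (suc m ℕ.* suc (suc m))
      ≤⟨ ℕ.*-monoʳ-≤ (2 ℕ.^ suc m) (ℕ.*-mono-≤ (ℕ.+-monoˡ-≤ m 1≤m) (ℕ.+-mono-≤ 1≤m (ℕ.+-monoˡ-≤ m 1≤m))) ⟩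
    2 ℕ.* 2 ℕ.^ m ℕ.* ((m ℕ.+ m) ℕ.* (m ℕ.+ (m ℕ.+ m)))
      ≡⟨ l (2 ℕ.^ m) m ⟩
    12 ℕ.* (2 ℕ.^ m ℕ.* (m ℕ.* (m ℕ.* 1)))
      ≤⟨ ℕ.*-monoʳ-≤ 12 (ℕ.*-monoʳ-≤ (2 ℕ.^ m) (ℕ.^-monoˡ-≤ 2 m≤log)) ⟩
    12 ℕ.* (2 ℕ.^ m ℕ.* ⌊log₂ n ⌋ ℕ.^ 2) ∎
    where
    open ℕ.≤-Reasoning
    l : ∀ a m → 2 ℕ.* a ℕ.* ((m ℕ.+ m) ℕ.* (m ℕ.+ (m ℕ.+ m))) ≡ 12 ℕ.* (a ℕ.* (m ℕ.* (m ℕ.* 1)))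
    l = ℕ-Solver.solve-∀
    m≤log : m ℕ.≤ ⌊log₂ n ⌋
    m≤log = subst (ℕ._≤ ⌊log₂ n ⌋) (⌊log₂[2^n]⌋≡n m) (⌊log₂⌋-mono-≤ (2^m≤n 1≤m))

  hardFrom : Σ[ N ∈ ℕ ] (N ℕ.≤ 2 ℕ.^ m ℕ.* suc m × ι (2 ℕ.^ m) * (1ℚ - ½^ m) ^ N ≤ ½ ×
               (1 ℕ.≤ m → 1ℚ ≤ ι 4 * (ι (2 ℕ.^ m) * (1ℚ - ½^ m) ^ N))) → Hard n
  hardFrom (N , N≤ , Mμ≤½ , 1≤4Mμ) = buildHard m N Mμ≤½ 1≤4Mμ (n ℕ.∸ N ℕ.* m)
    (trans (length-blocks m (n ℕ.∸ N ℕ.* m) N) (ℕ.m+[n∸m]≡n (Nm≤n N N≤)))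
    1≤m (λ 4≤n → 2^m≤n (1≤m 4≤n)) (Nm≤n N N≤) (λ 4≤n → n≤12·2ᵐ·log²n (1≤m 4≤n))

abstract

  hard : ∀ n → Hard n
  hard n = fromLast (lastTrue Fits (λ m → 2 ℕ.^ m ℕ.* (m ℕ.* suc m) ℕ.≤? n) z≤n (suc n) too-large)
    where
    Fits : ℕ → Set
    -- Room for 2ᵐ (m + 1) blocks of m bits, the upper bound on the number of blocks in
    -- `blockCount`.
    Fits m = 2 ℕ.^ m ℕ.* (m ℕ.* suc m) ℕ.≤ n
    too-large : ¬ Fits (suc n)
    too-large fits = ℕ.<⇒≱ (ℕ.n<1+n n) (ℕ.≤-trans
      (ℕ.≤-trans (ℕ.m≤m*n (suc n) (suc (suc n))) (ℕ.m≤n*m (suc n ℕ.* suc (suc n)) (2 ℕ.^ suc n) {{ℕ.m^n≢0 2 (suc n)}})) fits)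
    fromLast : Σ[ m ∈ ℕ ] (m ℕ.< suc n × Fits m × ¬ Fits (suc m)) → Hard n
    fromLast (m , _ , fits , ¬fits) = hardFrom n m fits ¬fits (blockCount m)

-- Approximating polynomials

private variable
  A : Set
  c : ℚ

sum-++ : (xs ys : List A) (g : A → ℚ) → sum (xs List.++ ys) g ≡ sum xs g + sum ys g
sum-++ []       ys g = sym (+-identityˡ (sum ys g))
sum-++ (x ∷ xs) ys g = trans (cong (g x +_) (sum-++ xs ys g)) (sym (+-assoc (g x) (sum xs g) (sum ys g)))

sum-map : {B : Set} (h : A → B) (xs : List A) (g : B → ℚ) → sum (List.map h xs) g ≡ sum xs (λ a → g (h a))
sum-map h []       g = refl
sum-map h (x ∷ xs) g = cong (g (h x) +_) (sum-map h xs g)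

sum-cong : (xs : List A) {f g : A → ℚ} → (∀ a → f a ≡ g a) → sum xs f ≡ sum xs g
sum-cong []       f≡g = refl
sum-cong (x ∷ xs) f≡g = cong₂ _+_ (f≡g x) (sum-cong xs f≡g)

sum-mono : (xs : List A) {f g : A → ℚ} → (∀ a → f a ≤ g a) → sum xs f ≤ sum xs g
sum-mono []       f≤g = ≤-refl
sum-mono (x ∷ xs) f≤g = +-mono-≤ (f≤g x) (sum-mono xs f≤g)

sum-affine : (xs : List A) (a b : ℚ) (g : A → ℚ) →
  sum xs (λ x → a * g x + b) ≡ a * sum xs g + ι (List.length xs) * b
sum-affine []       a b g = l a b
  where
  l : ∀ a b → 0ℚ ≡ a * 0ℚ + 0ℚ * b
  l = solve-∀ ℚ-ring
sum-affine (x ∷ xs) a b g = trans (cong (a * g x + b +_) (sum-affine xs a b g))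
  (trans (l a b (g x) (sum xs g) (ι (List.length xs)))
         (cong (λ i → a * (g x + sum xs g) + i * b) (sym (ι-suc (List.length xs)))))
  where
  l : ∀ a b c d i → a * c + b + (a * d + i * b) ≡ a * (c + d) + (1ℚ + i) * b
  l = solve-∀ ℚ-ring

sum-*ʳ : (xs : List A) (c : ℚ) (g : A → ℚ) → sum xs g * c ≡ sum xs (λ a → g a * c)
sum-*ʳ []       c g = *-zeroˡ c
sum-*ʳ (x ∷ xs) c g = trans (*-distribʳ-+ c (g x) (sum xs g)) (cong (g x * c +_) (sum-*ʳ xs c g))

-- Real expressions read at one index of their Cauchy sequences

seq-∑ : (xs : List A) (g : A → ℝ) (k : ℕ) → seq (∑ xs g) k ≡ sum xs (λ a → seq (g a) k)
seq-∑ []       g k = refl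
seq-∑ (x ∷ xs) g k = cong (seq (g x) k +_) (seq-∑ xs g k)

seq-bit : ∀ b k → seq (bit b) k ≡ bitℚ b
seq-bit true  k = refl
seq-bit false k = refl

-- Terms take exact rational values at every index; only the coefficients of the representation and
-- of the polynomial are approximated.
seq-termValue : (C : Term n) (x : Cube n) (k : ℕ) → seq (termValue C x) k ≡ termℚ C x
seq-termValue []               []      k = refl
seq-termValue (just true  ∷ C) (b ∷ x) k = cong₂ _*_ (seq-bit b k) (seq-termValue C x k)
seq-termValue (just false ∷ C) (b ∷ x) k = cong₂ _*_ (cong (λ a → 1ℚ - a) (seq-bit b k)) (seq-termValue C x k)
seq-termValue (nothing    ∷ C) (b ∷ x) k = seq-termValue C x k

½^*sum≡E : ∀ n (g : Cube n → ℚ) → ½^ n * sum (cubes n) g ≡ E g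
½^*sum≡E zero    g = trans (l (g [])) (sym (E-zero g))
  where
  l : ∀ a → 1ℚ * (a + 0ℚ) ≡ a
  l = solve-∀ ℚ-ring
½^*sum≡E (suc n) g = trans
  (cong (½ * ½^ n *_) (trans (sum-++ (List.map (true ∷_) (cubes n)) (List.map (false ∷_) (cubes n) List.++ []) g)
    (cong₂ _+_ (sum-map (true ∷_) (cubes n) g)
      (trans (sum-++ (List.map (false ∷_) (cubes n)) [] g) (cong (_+ 0ℚ) (sum-map (false ∷_) (cubes n) g))))))
  (trans (l (½^ n) (sum (cubes n) (at true g)) (sum (cubes n) (at false g)))
  (trans (cong₂ mean (½^*sum≡E n (at true g)) (½^*sum≡E n (at false g))) (sym (E-suc g))))
  where
  l : ∀ h a b → ½ * h * (a + (b + 0ℚ)) ≡ ½ * (h * a + h * b)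
  l = solve-∀ ℚ-ring

seq-𝔼 : (g : Cube n → ℝ) (k : ℕ) → seq (𝔼 g) k ≡ E (λ x → seq (g x) k)
seq-𝔼 {n} g k = trans (cong (½^ n *_) (seq-∑ (cubes n) g k)) (½^*sum≡E n (λ x → seq (g x) k))

p≤∣p∣ : ∀ p → p ≤ ℚ.∣ p ∣
p≤∣p∣ p with ≤-total 0ℚ p
... | inj₁ 0≤p = ≤-reflexive (sym (0≤p⇒∣p∣≡p 0≤p))
... | inj₂ p≤0 = ≤-trans p≤0 (0≤∣p∣ p)

∣p∣≤c⇒p²≤c² : ∀ p → ℚ.∣ p ∣ ≤ c → p * p ≤ c * c
∣p∣≤c⇒p²≤c² {c} p ∣p∣≤c = subst (_≤ c * c) (∣p∣² p) (*-mono (0≤∣p∣ p) (0≤∣p∣ p) ∣p∣≤c ∣p∣≤c)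
  where
  neg² : ∀ p → (ℚ.- p) * (ℚ.- p) ≡ p * p
  neg² = solve-∀ ℚ-ring
  ∣p∣² : ∀ p → ℚ.∣ p ∣ * ℚ.∣ p ∣ ≡ p * p
  ∣p∣² p with ∣p∣≡p∨∣p∣≡-p p
  ... | inj₁ eq = cong₂ _*_ eq eq
  ... | inj₂ eq = trans (cong₂ _*_ eq eq) (neg² p)

a*v≤∣a∣*b : ∀ a v {b} → v ≤ b → ℚ.- v ≤ b → a * v ≤ ℚ.∣ a ∣ * b
a*v≤∣a∣*b a v {b} v≤b -v≤b with ∣p∣≡p∨∣p∣≡-p a
... | inj₁ eq = subst (λ c → a * v ≤ c * b) (sym eq) (*-monoˡ (subst (0ℚ ≤_) eq (0≤∣p∣ a)) v≤b)
... | inj₂ eq = subst (λ c → a * v ≤ c * b) (sym eq)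
  (≤-trans (≤-reflexive (l a v)) (*-monoˡ (subst (0ℚ ≤_) eq (0≤∣p∣ a)) -v≤b))
  where
  l : ∀ a v → a * v ≡ (ℚ.- a) * (ℚ.- v)
  l = solve-∀ ℚ-ring

-- Dividing by `c + 1` instead of `c` covers c = 0, as occurs for degree 0.
shrink : ∀ c → 0ℚ ≤ c → ∀ ε → 0ℚ < ε → Σ[ δ ∈ ℚ ] (0ℚ < δ × c * δ ≤ ε)
shrink c 0≤c ε 0<ε = b⁻¹ * ε , positive⁻¹ (b⁻¹ * ε) {{δ-pos}} ,
  ≤-by (b⁻¹ * ε) (<⇒≤ (positive⁻¹ (b⁻¹ * ε) {{δ-pos}}))
    (trans (sym (trans (cong (_* ε) (*-inverseʳ b {{b≢0}})) (*-identityˡ ε))) (l c b⁻¹ ε))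
  where
  b : ℚ
  b = c + 1ℚ
  b-pos : ℚ.Positive b
  b-pos = nonNeg+pos⇒pos c {{ℚ.nonNegative 0≤c}} 1ℚ
  b≢0 : ℚ.NonZero b
  b≢0 = pos⇒nonZero b {{b-pos}}
  b⁻¹ : ℚ
  b⁻¹ = ℚ.1/_ b {{b≢0}}
  δ-pos : ℚ.Positive (b⁻¹ * ε)
  δ-pos = pos*pos⇒pos b⁻¹ {{1/pos⇒pos b {{b-pos}}}} ε {{ℚ.positive 0<ε}}
  l : ∀ c i ε → (c + 1ℚ) * i * ε ≡ c * (i * ε) + i * ε
  l = solve-∀ ℚ-ring

1/ℕ : (k : ℕ) .{{_ : ℕ.NonZero k}} → ℚ
1/ℕ k = ℤ.+ 1 ℚ./ k

-- The duality argument over ℚ, with error terms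

module _ {n} {f : Cube n → Bool} {d : ℕ} {κ : ℚ} (0≤κ : 0ℚ ≤ κ) (T : Test f d κ)
         (α : Term n → ℚ) (P : Cube n → ℚ) (ε : ℚ) where
  open Test T

  private
    terms : List (Term n)
    terms = allTerms n

  approximant : Cube n → ℚ
  approximant x = sum terms (λ C → α C * termℚ C x)

  termWeight : Term n → ℚ
  termWeight C = ℚ.∣ α C ∣ * ½^ ∣ C ∣ₜ

  E-1+hh : E (λ x → 1ℚ + h x * h x) ≤ ι 5
  E-1+hh = ≤-trans (≤-reflexive (trans (E-+ (λ _ → 1ℚ) (λ x → h x * h x)) (cong (_+ E (λ x → h x * h x)) (E-const n 1ℚ))))
    (+-monoʳ-≤ 1ℚ E-hh)

  -- Meant for terms longer than `d`, about which the test promises nothing: the second moment alone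
  -- gives ∣E[Ch]∣ ≤ 1 + 4 = 5, enough against coefficients of size ε.
  th≤1+hh : ∀ C x → termℚ C x * h x ≤ 1ℚ + h x * h x
  th≤1+hh C x = cases (termℚ-01 C x)
    where
    zero-case : ∀ h → 1ℚ + h * h ≡ 0ℚ * h + (1ℚ + h * h)
    zero-case = solve-∀ ℚ-ring
    one-case : ∀ h → 1ℚ + h * h ≡ 1ℚ * h + ((h - ½) * (h - ½) + (½ + ½ * ½))
    one-case = solve-∀ ℚ-ring
    cases : termℚ C x ≡ 0ℚ ⊎ termℚ C x ≡ 1ℚ → termℚ C x * h x ≤ 1ℚ + h x * h x
    cases (inj₁ eq) = subst (λ t → t * h x ≤ 1ℚ + h x * h x) (sym eq)
      (≤-by (1ℚ + h x * h x) (0≤+ 0≤1 (0≤² (h x))) (zero-case (h x)))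
    cases (inj₂ eq) = subst (λ t → t * h x ≤ 1ℚ + h x * h x) (sym eq)
      (≤-by ((h x - ½) * (h x - ½) + (½ + ½ * ½)) (0≤+ (0≤² (h x - ½)) (toWitness {a? = 0ℚ ≤? ½ + ½ * ½} _)) (one-case (h x)))

  -th≤1+hh : ∀ C x → ℚ.- (termℚ C x * h x) ≤ 1ℚ + h x * h x
  -th≤1+hh C x = cases (termℚ-01 C x)
    where
    zero-case : ∀ h → 1ℚ + h * h ≡ ℚ.- (0ℚ * h) + (1ℚ + h * h)
    zero-case = solve-∀ ℚ-ring
    one-case : ∀ h → 1ℚ + h * h ≡ ℚ.- (1ℚ * h) + ((h + ½) * (h + ½) + (½ + ½ * ½))
    one-case = solve-∀ ℚ-ring
    cases : termℚ C x ≡ 0ℚ ⊎ termℚ C x ≡ 1ℚ → ℚ.- (termℚ C x * h x) ≤ 1ℚ + h x * h x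
    cases (inj₁ eq) = subst (λ t → ℚ.- (t * h x) ≤ 1ℚ + h x * h x) (sym eq)
      (≤-by (1ℚ + h x * h x) (0≤+ 0≤1 (0≤² (h x))) (zero-case (h x)))
    cases (inj₂ eq) = subst (λ t → ℚ.- (t * h x) ≤ 1ℚ + h x * h x) (sym eq)
      (≤-by ((h x + ½) * (h x + ½) + (½ + ½ * ½)) (0≤+ (0≤² (h x + ½)) (toWitness {a? = 0ℚ ≤? ½ + ½ * ½} _)) (one-case (h x)))

  E-neg : (g : Cube n → ℚ) → E (λ x → ℚ.- g x) ≡ ℚ.- E g
  E-neg g = trans (E-cong λ x → l (g x)) (trans (E-*ˡ (ℚ.- 1ℚ) g) (sym (l (E g))))
    where
    l : ∀ a → ℚ.- a ≡ (ℚ.- 1ℚ) * a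
    l = solve-∀ ℚ-ring

  module _ (0≤ε : 0ℚ ≤ ε) (long : ∀ C → d ℕ.< ∣ C ∣ₜ → ℚ.∣ α C ∣ ≤ ε) where

    term≤ : ∀ C → α C * E (λ x → termℚ C x * h x) ≤ κ * termWeight C + ι 5 * ε
    term≤ C with ∣ C ∣ₜ ℕ.≤? d
    ... | yes ∣C∣≤d = ≤-trans (a*v≤∣a∣*b (α C) _ (E-Ch≤ C ∣C∣≤d) (-E-Ch≤ C ∣C∣≤d))
          (≤-by (ι 5 * ε) (0≤* (ι-nonNeg 5) 0≤ε) (cong (_+ ι 5 * ε) (l κ ℚ.∣ α C ∣ (½^ ∣ C ∣ₜ))))
      where
      l : ∀ κ a b → κ * (a * b) ≡ a * (κ * b)
      l = solve-∀ ℚ-ring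
    ... | no ∣C∣≰d = ≤-trans
          (a*v≤∣a∣*b (α C) (E (λ x → termℚ C x * h x)) (≤-trans (E-mono (th≤1+hh C)) E-1+hh)
            (≤-trans (≤-reflexive (sym (E-neg (λ x → termℚ C x * h x)))) (≤-trans (E-mono (-th≤1+hh C)) E-1+hh)))
          (≤-trans (*-monoʳ-≤-nonNeg (ι 5) {{ℚ.nonNegative (ι-nonNeg 5)}} (long C (ℕ.≰⇒> ∣C∣≰d)))
          (≤-by (κ * termWeight C) (0≤* 0≤κ (0≤* (0≤∣p∣ (α C)) (½^-nonNeg ∣ C ∣ₜ))) (l (κ * termWeight C) ε)))
      where
      l : ∀ a ε → a + ι 5 * ε ≡ ε * ι 5 + a
      l = solve-∀ ℚ-ring

    E-Ah≤ : E (λ x → approximant x * h x) ≤ κ * sum terms termWeight + ι (List.length terms) * (ι 5 * ε)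
    E-Ah≤ = ≤-trans (≤-reflexive eq) (≤-trans (sum-mono terms term≤)
      (≤-reflexive (sum-affine terms κ (ι 5 * ε) termWeight)))
      where
      eq : E (λ x → approximant x * h x) ≡ sum terms (λ C → α C * E (λ x → termℚ C x * h x))
      eq = trans (E-cong λ x → trans (sum-*ʳ terms (h x) (λ C → α C * termℚ C x)) (sum-cong terms λ C → *-assoc (α C) (termℚ C x) (h x)))
        (trans (E-sum terms (λ C x → α C * (termℚ C x * h x))) (sum-cong terms λ C → E-*ˡ (α C) (λ x → termℚ C x * h x)))

    -- The error budget: (a + b)² ≤ 2a² + 2b² with a second moment of 1/256 and a representation
    -- error of 1/16 gives 1/64 in `E-u²`. Then 8/64 + 4/32 = 1/4 in `E-fh-Ah≤`.
    module _ (close : E (λ x → (P x - bitℚ (f x)) * (P x - bitℚ (f x))) ≤ 1/ℕ 256)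
             (rep : ∀ x → ℚ.∣ approximant x - P x ∣ ≤ 1/ℕ 16)
             (small : ι (List.length terms) * (ι 5 * ε) ≤ 1/ℕ 8) where

      private
        u v : Cube n → ℚ
        u x = approximant x - bitℚ (f x)
        v x = P x - bitℚ (f x)

      u²≤ : ∀ x → u x * u x ≤ ι 2 * (v x * v x) + 1/ℕ 128
      u²≤ x = ≤-trans
        (≤-by ((v x - e) * (v x - e)) (0≤² (v x - e)) (trans (l (v x) e) (cong (λ a → a * a + (v x - e) * (v x - e)) (split (approximant x) (P x) (bitℚ (f x))))))
        (+-monoʳ-≤ (ι 2 * (v x * v x)) (*-monoˡ {ι 2} {e * e} (ι-nonNeg 2) (∣p∣≤c⇒p²≤c² e (rep x))))
        where
        e : ℚ
        e = approximant x - P x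
        l : ∀ v w → ι 2 * (v * v) + ι 2 * (w * w) ≡ (v + w) * (v + w) + (v - w) * (v - w)
        l = solve-∀ ℚ-ring
        split : ∀ a p f → p - f + (a - p) ≡ a - f
        split = solve-∀ ℚ-ring

      E-u² : E (λ x → u x * u x) ≤ 1/ℕ 64
      E-u² = ≤-trans (E-mono u²≤) (≤-trans
        (≤-reflexive (trans (E-+ (λ x → ι 2 * (v x * v x)) (λ _ → 1/ℕ 128)) (cong₂ _+_ (E-*ˡ (ι 2) (λ x → v x * v x)) (E-const n (1/ℕ 128)))))
        (+-monoˡ-≤ (1/ℕ 128) (*-monoˡ (ι-nonNeg 2) close)))

      -- AM–GM, weighted so that the two errors below are equal.
      fh-Ah≤ : ∀ x → h x * bitℚ (f x) - approximant x * h x ≤ ι 8 * (u x * u x) + 1/ℕ 32 * (h x * h x)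
      fh-Ah≤ x = ≤-by (ι 8 * ((u x + 1/ℕ 16 * h x) * (u x + 1/ℕ 16 * h x)))
        (0≤* (ι-nonNeg 8) (0≤² (u x + 1/ℕ 16 * h x))) (l (approximant x) (bitℚ (f x)) (h x))
        where
        l : ∀ a f h → ι 8 * ((a - f) * (a - f)) + 1/ℕ 32 * (h * h) ≡
          h * f - a * h + ι 8 * ((a - f + 1/ℕ 16 * h) * (a - f + 1/ℕ 16 * h))
        l = solve-∀ ℚ-ring

      E-fh-Ah≤ : E (λ x → h x * bitℚ (f x)) - E (λ x → approximant x * h x) ≤ 1/ℕ 4
      E-fh-Ah≤ = ≤-trans (≤-reflexive (sym (E-- (λ x → h x * bitℚ (f x)) (λ x → approximant x * h x))))
        (≤-trans (E-mono fh-Ah≤) (≤-trans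
          (≤-reflexive (trans (E-+ (λ x → ι 8 * (u x * u x)) (λ x → 1/ℕ 32 * (h x * h x)))
            (cong₂ _+_ (E-*ˡ (ι 8) (λ x → u x * u x)) (E-*ˡ (1/ℕ 32) (λ x → h x * h x)))))
          (+-mono-≤ (*-monoˡ {ι 8} (ι-nonNeg 8) E-u²) (*-monoˡ {1/ℕ 32} (toWitness {a? = 0ℚ ≤? 1/ℕ 32} _) E-hh))))

      -- Of the correlation ½ between `h` and `f`, the approximation error takes at most ¼ and the
      -- long terms at most ⅛; what remains must come from the weight.
      ⅛≤κ*weight : 1/ℕ 8 ≤ κ * sum terms termWeight
      ⅛≤κ*weight = ≤-by _ (0≤+ (0≤+ (0≤-diff E-hf) (0≤-diff E-fh-Ah≤)) (0≤+ (0≤-diff E-Ah≤) (0≤-diff small)))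
        (l (E (λ x → h x * bitℚ (f x))) (E (λ x → approximant x * h x)) (κ * sum terms termWeight) (ι (List.length terms) * (ι 5 * ε)))
        where
        l : ∀ a b w s → w ≡ 1/ℕ 8 + (((a - ½) + (1/ℕ 4 - (a - b))) + ((w + s - b) + (1/ℕ 8 - s)))
        l = solve-∀ ℚ-ring

Eventually-× : {P Q : ℕ → Set} → Eventually P → Eventually Q → Eventually λ k → P k × Q k
Eventually-× (K , P≥K) (L , Q≥L) = K ℕ.⊔ L , λ k le →
  P≥K k (ℕ.m⊔n≤o⇒m≤o K L le) , Q≥L k (ℕ.m⊔n≤o⇒n≤o K L le)

-- Finiteness of the cube and of the set of terms yields one index at which all approximations are
-- good simultaneously.
Eventually-All : (as : List A) {P : A → ℕ → Set} → (∀ a → Eventually (P a)) →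
  Eventually λ k → ∀ a → a ∈ as → P a k
Eventually-All []       ev = 0 , λ _ _ _ ()
Eventually-All (a ∷ as) {P} ev with Eventually-× (ev a) (Eventually-All as ev)
... | K , both = K , λ { k le _ (Any.here refl) → proj₁ (both k le)
                       ; k le b (Any.there b∈as) → proj₂ (both k le) b b∈as }

∈-allTerms : (C : Term n) → C ∈ allTerms n
∈-allTerms = ∈-allVecs _ λ { nothing → Any.here refl ; (just true) → Any.there (Any.here refl)
                           ; (just false) → Any.there (Any.there (Any.here refl)) }

-- From a single index back to real polynomials

module _ {n} (4≤n : 4 ℕ.≤ n) (H : Hard n) (p : MultilinearPolynomial n)
  (close : ∣ 𝔼 (λ x → (eval p x -ℝ bit (Hard.function H x)) ²) ∣ℝ ≤ℝ fromℚ (1/ℕ 512))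
  (d : ℕ) (α : Term n → ℝ) (α-rep : Represents α p) (deg : IsDegree p d) where

  open Hard H

  private
    L² : ℕ
    L² = ⌊log₂ n ⌋ ℕ.^ 2
    terms : List (Term n)
    terms = allTerms n

  LongSmall : ℚ → ℕ → Term n → Set
  LongSmall ε k C = d ℕ.< ∣ C ∣ₜ → ℚ.∣ seq (α C) k - 0ℚ ∣ ≤ ε

  long-small : ∀ ε → 0ℚ < ε → ∀ C → Eventually λ k → LongSmall ε k C
  long-small ε 0<ε C = cases (d ℕ.<? ∣ C ∣ₜ)
    where
    cases : Dec (d ℕ.< ∣ C ∣ₜ) → Eventually λ k → LongSmall ε k C
    cases (yes d<∣C∣) = proj₁ ev , λ k le _ → proj₂ ev k le
      where
      ev : Eventually λ k → ℚ.∣ seq (α C) k - 0ℚ ∣ ≤ ε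
      ev = proj₂ α-rep d deg C d<∣C∣ ε 0<ε
    cases (no d≮∣C∣) = 0 , λ _ _ d<∣C∣ → ⊥-elim (d≮∣C∣ d<∣C∣)

  module _ (κ : ℚ) (T : Test function d κ) (0≤κ : 0ℚ ≤ κ) (κn≤ : κ * ι n ≤ ι 24 * (ι d * ι L²))
           (ε : ℚ) (0<ε : 0ℚ < ε) (small : ι (List.length terms) * ι 5 * ε ≤ 1/ℕ 8) where

    -- The constant is 192 = 8 · 24: multiply ⅛ ≤ κW by n and insert κn ≤ 24 d log² n.
    n≤192*weightₖ : ∀ k →
      seq ∣ 𝔼 (λ x → (eval p x -ℝ bit (function x)) ²) ∣ℝ k ≤ 1/ℕ 512 + 1/ℕ 512 →
      (∀ x → x ∈ cubes n → ℚ.∣ seq (∑ terms (λ C → α C *ℝ termValue C x)) k - seq (eval p x) k ∣ ≤ 1/ℕ 16) →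
      (∀ C → C ∈ terms → LongSmall ε k C) →
      1/ℕ 192 * ι n ≤ ι d * ι L² * seq (weight α) k
    n≤192*weightₖ k closeₖ′ repₖ′ longₖ′ = ≤-trans
      (≤-trans (≤-reflexive (l₁ (ι n))) (*-monoˡ {1/ℕ 24} (toWitness {a? = 0ℚ ≤? 1/ℕ 24} _)
        (≤-trans (*-monoʳ-≤-nonNeg (ι n) {{ℚ.nonNegative (ι-nonNeg n)}} ⅛≤)
        (≤-trans (≤-reflexive (l₂ κ W (ι n))) (*-monoˡ 0≤W κn≤)))))
      (≤-reflexive (trans (l₃ W (ι d) (ι L²)) (cong (ι d * ι L² *_) (sym (seq-∑ terms _ k)))))
      where
      αₖ : Term n → ℚ
      αₖ C = seq (α C) k
      W : ℚ
      W = sum terms (λ C → ℚ.∣ αₖ C ∣ * ½^ ∣ C ∣ₜ)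
      0≤W : 0ℚ ≤ W
      0≤W = subst (_≤ W) (trans (sum-affine terms 0ℚ 0ℚ (λ _ → 0ℚ)) (l (sum terms (λ _ → 0ℚ)) (ι (List.length terms))))
        (sum-mono terms λ C → 0≤* (0≤∣p∣ (αₖ C)) (½^-nonNeg ∣ C ∣ₜ))
        where
        l : ∀ a b → 0ℚ * a + b * 0ℚ ≡ 0ℚ
        l = solve-∀ ℚ-ring
      P : Cube n → ℚ
      P x = seq (eval p x) k
      closeₖ : E (λ x → (P x - bitℚ (function x)) * (P x - bitℚ (function x))) ≤ 1/ℕ 256
      closeₖ = ≤-trans (≤-reflexive (trans
          (E-cong λ x → cong (λ b → (P x - b) * (P x - b)) (sym (seq-bit (function x) k)))
          (sym (seq-𝔼 (λ x → (eval p x -ℝ bit (function x)) ²) k))))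
        (≤-trans (p≤∣p∣ _) closeₖ′)
      repₖ : ∀ x → ℚ.∣ sum terms (λ C → αₖ C * termℚ C x) - P x ∣ ≤ 1/ℕ 16
      repₖ x = subst (λ a → ℚ.∣ a - P x ∣ ≤ 1/ℕ 16)
        (trans (seq-∑ terms (λ C → α C *ℝ termValue C x) k) (sum-cong terms λ C → cong (αₖ C *_) (seq-termValue C x k)))
        (repₖ′ x (∈-cubes x))
      longₖ : ∀ C → d ℕ.< ∣ C ∣ₜ → ℚ.∣ αₖ C ∣ ≤ ε
      longₖ C d<∣C∣ = subst (λ a → ℚ.∣ a ∣ ≤ ε) (+-identityʳ (αₖ C)) (longₖ′ C (∈-allTerms C) d<∣C∣)
      ⅛≤ : 1/ℕ 8 ≤ κ * W
      ⅛≤ = ⅛≤κ*weight 0≤κ T αₖ P ε (<⇒≤ 0<ε) longₖ closeₖ repₖ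
        (subst (_≤ 1/ℕ 8) (*-assoc (ι (List.length terms)) (ι 5) ε) small)
      l₁ : ∀ a → 1/ℕ 192 * a ≡ 1/ℕ 24 * (1/ℕ 8 * a)
      l₁ = solve-∀ ℚ-ring
      l₂ : ∀ κ w a → κ * w * a ≡ w * (κ * a)
      l₂ = solve-∀ ℚ-ring
      l₃ : ∀ w d L → 1/ℕ 24 * (w * (ι 24 * (d * L))) ≡ d * L * w
      l₃ = solve-∀ ℚ-ring

    n≤192*weight′ : Eventually λ k → 1/ℕ 192 * ι n ≤ ι d * ι L² * seq (weight α) k
    n≤192*weight′ = proj₁ facts , λ k le → n≤192*weightₖ k
      (proj₁ (proj₂ facts k le)) (proj₁ (proj₂ (proj₂ facts k le))) (proj₂ (proj₂ (proj₂ facts k le)))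
      where
      facts : Eventually λ k →
        seq ∣ 𝔼 (λ x → (eval p x -ℝ bit (function x)) ²) ∣ℝ k ≤ 1/ℕ 512 + 1/ℕ 512 ×
        (∀ x → x ∈ cubes n → ℚ.∣ seq (∑ terms (λ C → α C *ℝ termValue C x)) k - seq (eval p x) k ∣ ≤ 1/ℕ 16) ×
        (∀ C → C ∈ terms → LongSmall ε k C)
      facts = Eventually-×
        -- An inequality of reals gives one between entries only up to a slack. Taking the slack to
        -- be 1/512 as well gives the 1/256 of the error budget.
        (close (1/ℕ 512) (toWitness {a? = 0ℚ <? 1/ℕ 512} _))
        (Eventually-× (Eventually-All (cubes n) (λ x → proj₁ α-rep x (1/ℕ 16) (toWitness {a? = 0ℚ <? 1/ℕ 16} _)))
                      (Eventually-All terms (long-small ε 0<ε)))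

  n≤192*weight : Eventually λ k → 1/ℕ 192 * ι n ≤ ι d * ι L² * seq (weight α) k
  n≤192*weight = n≤192*weight′ (proj₁ t) (proj₁ (proj₂ t)) (proj₁ (proj₂ (proj₂ t))) (proj₂ (proj₂ (proj₂ t)))
    (proj₁ δ₀) (proj₁ (proj₂ δ₀)) (proj₂ (proj₂ δ₀))
    where
    t : Σ[ κ ∈ ℚ ] (Test function d κ × 0ℚ ≤ κ × κ * ι n ≤ ι 24 * (ι d * ι L²))
    t = test 4≤n d
    δ₀ : Σ[ ε ∈ ℚ ] (0ℚ < ε × ι (List.length terms) * ι 5 * ε ≤ 1/ℕ 8)
    δ₀ = shrink (ι (List.length terms) * ι 5) (0≤* (ι-nonNeg (List.length terms)) (ι-nonNeg 5)) (1/ℕ 8) (toWitness {a? = 0ℚ <? 1/ℕ 8} _)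

  n≤192*φ : ∀ φ → weight α ≃ φ → fromℚ (1/ℕ 192) *ℝ fromℕ n ≤ℝ (fromℕ d *ℝ φ) *ℝ fromℕ L²
  n≤192*φ φ w≃φ ε 0<ε = proj₁ facts , λ k le → step k (proj₁ (proj₂ facts k le)) (proj₂ (proj₂ facts k le))
    where
    δ₀ : Σ[ δ ∈ ℚ ] (0ℚ < δ × ι d * ι L² * δ ≤ ε)
    -- The error made in passing from the weight to φ is later multiplied by d log² n.
    δ₀ = shrink (ι d * ι L²) (0≤* (ι-nonNeg d) (ι-nonNeg L²)) ε 0<ε
    δ′ : ℚ
    δ′ = proj₁ δ₀
    facts : Eventually λ k → 1/ℕ 192 * ι n ≤ ι d * ι L² * seq (weight α) k × ℚ.∣ seq (weight α) k - seq φ k ∣ ≤ δ′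
    facts = Eventually-× n≤192*weight (w≃φ δ′ (proj₁ (proj₂ δ₀)))
    split : ∀ a b → a ≡ b + (a - b)
    split = solve-∀ ℚ-ring
    l : ∀ d L φ δ → d * L * (φ + δ) ≡ d * φ * L + d * L * δ
    l = solve-∀ ℚ-ring
    step : ∀ k → 1/ℕ 192 * ι n ≤ ι d * ι L² * seq (weight α) k → ℚ.∣ seq (weight α) k - seq φ k ∣ ≤ δ′ →
      1/ℕ 192 * ι n ≤ ι d * seq φ k * ι L² + ε
    step k bound near = ≤-trans bound (≤-trans
      (*-monoˡ (0≤* (ι-nonNeg d) (ι-nonNeg L²))
        (≤-trans (≤-reflexive (split (seq (weight α) k) (seq φ k))) (+-monoʳ-≤ (seq φ k) (≤-trans (p≤∣p∣ _) near))))
      (≤-trans (≤-reflexive (l (ι d) (ι L²) (seq φ k) δ′)) (+-monoʳ-≤ (ι d * seq φ k * ι L²) (proj₂ (proj₂ δ₀)))))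

theorem21 : Σ[ f ∈ BooleanFamily ]
    ( AC⁰-ofDepth 3 f
    × ((p : ∀ n → MultilinearPolynomial n) →
    Vanishing (λ n → 𝔼 (λ x → (eval (p n) x -ℝ bit (f n x)) ²)) →
    Σ[ c ∈ ℚ ]
    ( (0ℚ ℚ.< c)
    × Eventually (λ n →
    ∀ d φ → IsDegree (p n) d → IsFat (p n) φ →
    fromℚ c *ℝ fromℕ n ≤ℝ
    (fromℕ d *ℝ φ) *ℝ fromℕ (⌊log₂ n ⌋ ℕ.^ 2)))))
theorem21 =
  (λ n → Hard.function (hard n)) ,
  ((λ n → Hard.C (hard n)) , (λ n → Hard.run≡ (hard n)) , (λ n → Hard.depth≤3 (hard n)) , 3 , 4 , λ n → Hard.size≤n³ (hard n)) ,
  -- The constant is the same for all `p`. Only the threshold depends on `p`, through the length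
  -- beyond which the squared error stays below 1/512.
  λ p vanishing → 1/ℕ 192 , toWitness {a? = 0ℚ <? 1/ℕ 192} _ ,
    lowerBound p (Eventually-× (4 , λ n 4≤n → 4≤n) (vanishing (1/ℕ 512) (toWitness {a? = 0ℚ <? 1/ℕ 512} _)))
  where
  lowerBound : (p : ∀ n → MultilinearPolynomial n) →
    Eventually (λ n → 4 ℕ.≤ n × ∣ 𝔼 (λ x → (eval (p n) x -ℝ bit (Hard.function (hard n) x)) ²) ∣ℝ ≤ℝ fromℚ (1/ℕ 512)) →
    Eventually (λ n → ∀ d φ → IsDegree (p n) d → IsFat (p n) φ →
      fromℚ (1/ℕ 192) *ℝ fromℕ n ≤ℝ (fromℕ d *ℝ φ) *ℝ fromℕ (⌊log₂ n ⌋ ℕ.^ 2))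
  lowerBound p (K , facts) = K , λ n K≤n d φ deg fat → n≤192*φ (proj₁ (facts n K≤n)) (hard n) (p n) (proj₂ (facts n K≤n))
    d (proj₁ (proj₁ fat)) (proj₁ (proj₂ (proj₁ fat))) deg φ (proj₂ (proj₂ (proj₁ fat)))
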